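{- Let $L$ be a parameterized problem with propositional translation $(x,k)\mapsto\Phi(x,k)$ (so that $\Phi(x,k)$ is unsatisfiable for every negative instance $(x,k)\notin L$), and suppose that $L$ is kernelizable via a finite number of data reduction rules $(A_1,A_2,\ldots,A_r)$ with kernel size $g(\cdot)$. 1. Assume that every negative instance $(x,k)$ of $L$ has a data reduction chain of length $C(x,k)$, and that the soundness of each reduction rule $A_1,\ldots,A_r$ can be witnessed using extended Frege proofs of size at most $h(|\Phi(x,k)|)$, for some function $h(\cdot)$, with case bound $R\ge 1$. Then negative instances $\Phi(x,k)$ of $L$ have extended Frege proofs (of unsatisfiability) of size $$O\Big(\Big(\sum_{i=0}^{C(x,k)} R^{i}\Big)\big[h(|\Phi(x,k)|)+2^{O(\mathrm{poly}(g(k)))}\big]\Big).$$ In particular, if $R=1$ and for every fixed $k$ we have $C(x,k)=O(\mathrm{poly}(|\Phi(x,k)|))$ then, for every fixed $k$, negative instances $\Phi(x,k)$ of $L$ have extended Frege proofs of size polynomial in $|\Phi(x,k)|$. 2. Assume that negative instances $(x,k)$ of $L$ have data reduction chains of length $C(x,k)=O(1)$ (respectively $C(x,k)=O(\log|\Phi(x,k)|)$), where the constant may depend on $k$, and that the safety of each reduction $\Phi(x_i,k_i)\vdash\Phi(x_{i+1},k_{i+1})$ in the chain is witnessed by Frege proofs of size at most $p(|\Phi(x,k)|)$, for some fixed polynomial $p(\cdot)$. Then for every fixed $k$, negative instances $\Phi(x,k)$ of $L$ have Frege proofs of size polynomial (respectively quasipolynomial) in $|\Phi(x,k)|$.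
   Context: Proof systems. A Frege system is a sound and complete propositional proof system with finitely many axiom schemes and inference rules (all are polynomially equivalent; fix one whose only rule is modus ponens). Extended Frege proofs may in addition introduce new variables as abbreviations for formulas. The length (size) of a proof is measured by the number of clauses in it. A proof "for" an unsatisfiable formula means a refutation of it. A function $f$ is quasipolynomial if $f(n)=O(2^{O(\log^{c} n)})$ for some $c>0$. Witnessing an implication $\Phi_1\vdash\Phi_2$ by (extended) Frege proofs means: $\Phi_1,\Phi_2$ have disjoint variable sets $X,Y$ and there are substitutions $Y_i=\Xi_i[X]$ such that the clauses of $\Phi_2[Y]$ can be derived using the clauses of $\Phi_1[X]$ as axioms. (These are extended Frege proofs; to get Frege proofs the definitions of the new variables are expanded.) Parameterized notions. A parameterized problem is a set $L\subseteq\Sigma^*\times\mathbb N$. A fixed canonical reduction assigns to each instance $(x,k)$ a CNF formula $\Phi(x,k)$, satisfiable iff $(x,k)\in L$; $(x,k)\notin L$ is called a negative instance. A data reduction rule for $L$ is an algorithm running in time polynomial in $|x|+k$ that maps $(x,k)$ to $(x',k')$ with $(x,k)\in L\iff(x',k')\in L$ and $|x'|\le|x|$ (a rule may be the identity on small instances). A kernelization for $L$ is a polynomial-time algorithm mapping $(x,k)$ to $(x',k')$ (the kernel) with $(x,k)\in L\iff(x',k')\in L$ and $|x'|,k'\le g(k)$ for a computable function $g$, the size of the kernel; $L$ is kernelizable via rules $A_1,\dots,A_r$ if applying the rules as long as possible is a kernelization. A data reduction chain for $(x,k)$ is a sequence $(x_0,k_0)=(x,k),(x_1,k_1),\ldots,(x_m,k_m)$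 with, for each $i\geq 1$, $(x_i,k_i)=A_j(x_{i-1},k_{i-1})$ for some $j$, and $A_t(x_m,k_m)=(x_m,k_m)$ for all $t$; $m$ is its length. Soundness. The soundness of the rules has (extended) Frege proofs of size $h(\cdot)$ (with case bound $R$) if there is an integer $R\ge1$ such that for every $(x,k)\notin L$ and every step $(x_i,k_i)\to(x_{i+1},k_{i+1})$ of the reduction chain of $(x,k)$: there exist $r'_i\le R$, a tautology $\Xi_i=\bigvee_{t=1}^{r'_i}\Xi_{i,t}$ and formulas $\eta_{i,1},\ldots,\eta_{i,r'_i}$, each isomorphic up to variable renaming to $\Phi(x_{i+1},k_{i+1})$, such that $\Phi(x_i,k_i)\wedge\Xi_{i,t}\vdash\eta_{i,t}$ for all $t$; and proving $\Xi_i$ together with all these implications can be accomplished by (extended) Frege proofs of total size at most $h(|\Phi(x,k)|)$.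
   Formalization: In the "in particular" sentence of part 1, h is additionally assumed polynomially bounded; with h arbitrary, as written, that sentence would give polynomial-size extended Frege refutations of all unsatisfiable CNFs, hence NP = coNP. -}

module Defs where

open import Data.Bool using (Bool; true; false; not; _∧_; _∨_)
open import Data.Fin using (Fin)
open import Data.List using (List; []; _∷_; [_]; _++_; map; concatMap; foldr; length; replicate; sum)
open import Data.List.Membership.Propositional using (_∈_; _∉_)
open import Data.List.Relation.Binary.Disjoint.Propositional using (Disjoint)
open import Data.List.Relation.Binary.Subset.Propositional using (_⊆_)
open import Data.List.Relation.Unary.All using (All)
open import Data.Maybe using (Maybe; just; nothing)
open import Data.Nat using (ℕ; suc; _+_; _*_; _^_; _≤_; _<_)
open import Data.Nat.Binary using (ℕᵇ; 2[1+_]; 1+[2_]; fromℕ)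
open import Data.Nat.Logarithm using (⌊log₂_⌋)
open import Data.Product using (Σ; ∃-syntax; _×_; _,_; proj₁; proj₂)
open import Function using (_⇔_)
open import Level using (0ℓ)
open import Relation.Binary.PropositionalEquality using (_≡_)
open import Relation.Nullary using (¬_)
open import Relation.Unary using (Pred)

-- Coefficients, constant term first.
Poly : Set
Poly = List ℕ

eval : Poly → ℕ → ℕ
eval p n = foldr (λ a v → a + n * v) 0 p

infix 4 _=O_

_=O_ : (ℕ → ℕ) → (ℕ → ℕ) → Set
f =O g = ∃[ c ] ∃[ n₀ ] (∀ n → n₀ ≤ n → f n ≤ c * g n)

PolyBounded : (ℕ → ℕ) → Set
PolyBounded f = ∃[ p ] f =O eval p

-- A natural exponent c loses nothing: a real one can be rounded up.
QuasiPolynomial : (ℕ → ℕ) → Set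
QuasiPolynomial f =
  ∃[ c ] 0 < c × Σ (ℕ → ℕ) λ e →
    (e =O λ n → ⌊log₂ n ⌋ ^ c) × (f =O λ n → 2 ^ e n)

Var : Set
Var = ℕ

infix  25 ¬ᶠ_
infixr 22 _∧ᶠ_
infixr 21 _∨ᶠ_
infixr 20 _⇒ᶠ_
infix  19 _⇔ᶠ_

data Formula : Set where
  var            : Var → Formula
  ⊥ᶠ             : Formula
  ¬ᶠ_            : Formula → Formula
  _∧ᶠ_ _∨ᶠ_ _⇒ᶠ_ : Formula → Formula → Formula

_⇔ᶠ_ : Formula → Formula → Formula
A ⇔ᶠ B = (A ⇒ᶠ B) ∧ᶠ (B ⇒ᶠ A)

⋁ : List Formula → Formula
⋁ = foldr _∨ᶠ_ ⊥ᶠ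

vars : Formula → List Var
vars (var x)  = [ x ]
vars ⊥ᶠ       = []
vars (¬ᶠ A)   = vars A
vars (A ∧ᶠ B) = vars A ++ vars B
vars (A ∨ᶠ B) = vars A ++ vars B
vars (A ⇒ᶠ B) = vars A ++ vars B

varsOf : List Formula → List Var
varsOf = concatMap vars

Subst : Set
Subst = Var → Formula

infixl 30 _⟨_⟩

_⟨_⟩ : Formula → Subst → Formula
var x    ⟨ σ ⟩ = σ x
⊥ᶠ       ⟨ σ ⟩ = ⊥ᶠ
(¬ᶠ A)   ⟨ σ ⟩ = ¬ᶠ (A ⟨ σ ⟩)
(A ∧ᶠ B) ⟨ σ ⟩ = (A ⟨ σ ⟩) ∧ᶠ (B ⟨ σ ⟩)
(A ∨ᶠ B) ⟨ σ ⟩ = (A ⟨ σ ⟩) ∨ᶠ (B ⟨ σ ⟩)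
(A ⇒ᶠ B) ⟨ σ ⟩ = (A ⟨ σ ⟩) ⇒ᶠ (B ⟨ σ ⟩)

Valuation : Set
Valuation = Var → Bool

truth : Valuation → Formula → Bool
truth v (var x)  = v x
truth v ⊥ᶠ       = false
truth v (¬ᶠ A)   = not (truth v A)
truth v (A ∧ᶠ B) = truth v A ∧ truth v B
truth v (A ∨ᶠ B) = truth v A ∨ truth v B
truth v (A ⇒ᶠ B) = not (truth v A) ∨ truth v B

_⊨_ : Valuation → Formula → Set
v ⊨ A = truth v A ≡ true

Tautology : Formula → Set
Tautology A = ∀ v → v ⊨ A

data Literal : Set where
  pos neg : Var → Literal

Clause : Set
Clause = List Literal

CNF : Set
CNF = List Clause

literalFormula : Literal → Formula
literalFormula (pos x) = var x
literalFormula (neg x) = ¬ᶠ var x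

clauseFormula : Clause → Formula
clauseFormula C = ⋁ (map literalFormula C)

clauses : CNF → List Formula
clauses = map clauseFormula

cnfVars : CNF → List Var
cnfVars Φ = varsOf (clauses Φ)

Satisfiable : CNF → Set
Satisfiable Φ = ∃[ v ] All (v ⊨_) (clauses Φ)

-- |Φ|: each literal occurrence and each clause counts one.
∣_∣ : CNF → ℕ
∣ Φ ∣ = sum (map (λ C → suc (length C)) Φ)

renameLiteral : (Var → Var) → Literal → Literal
renameLiteral ρ (pos x) = pos (ρ x)
renameLiteral ρ (neg x) = neg (ρ x)

rename : (Var → Var) → CNF → CNF
rename ρ = map (map (renameLiteral ρ))

record IsRenamingOf (η Φ : CNF) : Set where
  field
    ρ         : Var → Var
    injective : ∀ {x y} → x ∈ cnfVars Φ → y ∈ cnfVars Φ → ρ x ≡ ρ y → x ≡ y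
    renamed   : η ≡ rename ρ Φ

data Kind : Set where
  frege extended : Kind

-- Proof Ax κ Γ Δ ls: the list ls, most recent line first, is a proof from
-- the axiom schemes Ax (given as formulas whose variables are the
-- metavariables) and the hypotheses Γ.  The intended conclusions Δ matter
-- only for freshness: an extension variable must not occur in them.
data Proof (Ax : List Formula) : Kind → (Γ Δ : List Formula) → List Formula → Set where
  done : ∀ {κ Γ Δ} → Proof Ax κ Γ Δ []
  hyp  : ∀ {κ Γ Δ ls A} → A ∈ Γ →
         Proof Ax κ Γ Δ ls → Proof Ax κ Γ Δ (A ∷ ls)
  ax   : ∀ {κ Γ Δ ls S} → S ∈ Ax → (σ : Subst) →
         Proof Ax κ Γ Δ ls → Proof Ax κ Γ Δ (S ⟨ σ ⟩ ∷ ls)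
  mp   : ∀ {κ Γ Δ ls A B} → A ∈ ls → (A ⇒ᶠ B) ∈ ls →
         Proof Ax κ Γ Δ ls → Proof Ax κ Γ Δ (B ∷ ls)
  ext  : ∀ {Γ Δ ls} (q : Var) (A : Formula) →
         q ∉ varsOf (A ∷ ls ++ Γ ++ Δ) →
         Proof Ax extended Γ Δ ls → Proof Ax extended Γ Δ ((var q ⇔ᶠ A) ∷ ls)

record Derivation (Ax : List Formula) (κ : Kind) (Γ Δ : List Formula) : Set where
  field
    lines     : List Formula
    proof     : Proof Ax κ Γ Δ lines
    concludes : Δ ⊆ lines

  size : ℕ
  size = length lines

record FregeSystem : Set where
  field
    schemes  : List Formula
    sound    : ∀ {A} → Derivation schemes frege [] [ A ] → Tautology A
    complete : ∀ {A} → Tautology A → Derivation schemes frege [] [ A ]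

module _ (F : FregeSystem) where

  open FregeSystem F

  Refutable : Kind → CNF → ℕ → Set
  Refutable κ Φ s =
    Σ (Derivation schemes κ (clauses Φ) [ ⊥ᶠ ]) λ d → Derivation.size d ≤ s

  -- The proof underlying a witnessed implication Γ ⊢ η with Y = σ[X].
  -- In the extended case the equivalences y ↔ σ y are available as
  -- additional hypotheses, each costing one line when used; in the Frege
  -- case these definitions are expanded.
  WitnessProof : Kind → List Formula → CNF → Subst → Set
  WitnessProof frege    Γ η σ =
    Derivation schemes frege Γ (map (_⟨ σ ⟩) (clauses η))
  WitnessProof extended Γ η σ =
    Derivation schemes extended
      (Γ ++ map (λ y → var y ⇔ᶠ σ y) (cnfVars η)) (clauses η)

  witnessSize : ∀ κ {Γ η σ} → WitnessProof κ Γ η σ → ℕ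
  witnessSize frege    d = Derivation.size d
  witnessSize extended d = Derivation.size d

  record Witness (κ : Kind) (Γ : List Formula) (η : CNF) : Set where
    field
      disjoint : Disjoint (varsOf Γ) (cnfVars η)
      σ        : Subst
      over     : ∀ {y} → y ∈ cnfVars η → vars (σ y) ⊆ varsOf Γ
      proof    : WitnessProof κ Γ η σ

    size : ℕ
    size = witnessSize κ proof

  record Case (κ : Kind) (Φ Φ′ : CNF) : Set where
    field
      Ξ       : Formula
      η       : CNF
      copy    : IsRenamingOf η Φ′
      witness : Witness κ (clauses Φ ++ [ Ξ ]) η

  record StepSound (κ : Kind) (R s : ℕ) (Φ Φ′ : CNF) : Set where
    field
      cases : List (Case κ Φ Φ′)
      bound : length cases ≤ R

    disjunction : Formula
    disjunction = ⋁ (map Case.Ξ cases)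

    field
      tautology  : Tautology disjunction
      derivation : Derivation schemes κ [] [ disjunction ]
      total      : Derivation.size derivation
                   + sum (map (λ c → Witness.size (Case.witness c)) cases) ≤ s

  -- Φ and Φ′ may share variables, so Φ′ is first renamed apart.
  Safe : Kind → ℕ → CNF → CNF → Set
  Safe κ s Φ Φ′ =
    Σ CNF λ η → IsRenamingOf η Φ′ ×
      Σ (Witness κ (clauses Φ) η) λ w → Witness.size w ≤ s

data Move : Set where
  left stay right : Move

module _ (σ : ℕ) where

  data Letter : Set where
    letter           : Fin σ → Letter
    bit              : Bool → Letter
    comma semicolon  : Letter

  Word : Set
  Word = List Letter

  data Symbol (work : ℕ) : Set where
    blank : Symbol work
    io    : Letter → Symbol work
    extra : Fin work → Symbol work

  -- Deterministic, one two-way infinite tape; δ yields nothing to halt.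
  record Machine : Set where
    field
      states work : ℕ
      start       : Fin states
      δ           : Fin states → Symbol work → Maybe (Fin states × Symbol work × Move)

-- The cells left of the head (nearest first), the scanned cell, and the cells
-- to its right; all further cells are blank.
record Tape (σ work : ℕ) : Set where
  constructor tape
  field
    before  : List (Symbol σ work)
    scanned : Symbol σ work
    after   : List (Symbol σ work)

module _ {σ : ℕ} where

  move : ∀ {work} → Move → Tape σ work → Tape σ work
  move left  (tape [] s r)      = tape [] blank (s ∷ r)
  move left  (tape (a ∷ l) s r) = tape l a (s ∷ r)
  move stay  t                  = t
  move right (tape l s [])      = tape (s ∷ l) blank []
  move right (tape l s (b ∷ r)) = tape (s ∷ l) b r

  write : ∀ {work} → Symbol σ work → Tape σ work → Tape σ work
  write s (tape l _ r) = tape l s r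

  input : ∀ {work} → Word σ → Tape σ work
  input []      = tape [] blank []
  input (a ∷ w) = tape [] (io a) (map io w)

  Outputs : ∀ {work} → Tape σ work → Word σ → Set
  Outputs (tape l s r) w = ∃[ m ] s ∷ r ≡ map io w ++ replicate m blank

  module _ (M : Machine σ) where
    open Machine M

    data HaltsFrom : Fin states → Tape σ work → ℕ → Tape σ work → Set where
      halt : ∀ {q t} → δ q (Tape.scanned t) ≡ nothing → HaltsFrom q t 0 t
      step : ∀ {q t q′ s d n u} → δ q (Tape.scanned t) ≡ just (q′ , s , d) →
             HaltsFrom q′ (move d (write s t)) n u → HaltsFrom q t (suc n) u

    Computes : Word σ → ℕ → Word σ → Set
    Computes w n w′ = ∃[ u ] HaltsFrom start (input w) n u × Outputs u w′

Computable : (ℕ → ℕ) → Set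
Computable g =
  Σ (Machine 0) λ M → ∀ n → ∃[ t ] Computes M (unary n) t (unary (g n))
  where
  unary : ℕ → Word 0
  unary n = replicate n (bit true)

Instance : ℕ → Set
Instance σ = List (Fin σ) × ℕ

ParamProblem : ℕ → Set₁
ParamProblem σ = Pred (Instance σ) 0ℓ

module _ {σ : ℕ} where

  -- The parameter is written in unary, so that the input length is, up to the
  -- separator, |x| + k.
  codeInstance : Instance σ → Word σ
  codeInstance (x , k) = map letter x ++ comma ∷ replicate k (bit true)

  codeVar : Var → Word σ
  codeVar x = digits (fromℕ x)
    where
    digits : ℕᵇ → Word σ
    digits ℕᵇ.zero  = []
    digits 2[1+ b ] = bit false ∷ digits b
    digits 1+[2 b ] = bit true ∷ digits b

  codeLiteral : Literal → Word σ
  codeLiteral (pos x) = bit true ∷ codeVar x ++ [ comma ]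
  codeLiteral (neg x) = bit false ∷ codeVar x ++ [ comma ]

  codeCNF : CNF → Word σ
  codeCNF = concatMap (λ C → concatMap codeLiteral C ++ [ semicolon ])

  PolyTime : {B : Set} → (B → Word σ) → (Instance σ → B) → Set
  PolyTime code f =
    Σ (Machine σ) λ M → Σ Poly λ p → ∀ i →
      ∃[ t ] t ≤ eval p (length (proj₁ i) + proj₂ i) ×
             Computes M (codeInstance i) t (code (f i))

module _ {σ : ℕ} (L : ParamProblem σ) where

  Negative : Instance σ → Set
  Negative i = ¬ L i

  record Translation : Set where
    field
      Φ        : Instance σ → CNF
      correct  : ∀ i → Satisfiable (Φ i) ⇔ L i
      polyTime : PolyTime codeCNF Φ

  record Rule : Set where
    field
      apply         : Instance σ → Instance σ
      polyTime      : PolyTime codeInstance apply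
      equivalent    : ∀ i → L i ⇔ L (apply i)
      nonincreasing : ∀ i → length (proj₁ (apply i)) ≤ length (proj₁ i)

  SizeAtMost : ℕ → Instance σ → Set
  SizeAtMost b (x , k) = length x ≤ b × k ≤ b

  record IsKernelization (g : ℕ → ℕ) (K : Instance σ → Instance σ) : Set where
    field
      polyTime   : PolyTime codeInstance K
      equivalent : ∀ i → L i ⇔ L (K i)
      computable : Computable g
      small      : ∀ i → SizeAtMost (g (proj₂ i)) (K i)

module _ {σ : ℕ} {L : ParamProblem σ} {r : ℕ} (A : Fin r → Rule L) where

  data Chain : Instance σ → ℕ → Set where
    stop : ∀ {i} → (∀ t → Rule.apply (A t) i ≡ i) → Chain i 0
    step : ∀ {i m} (j : Fin r) → Chain (Rule.apply (A j) i) m → Chain i (suc m)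

  end : ∀ {i m} → Chain i m → Instance σ
  end {i} (stop _)   = i
  end     (step _ c) = end c

  steps : ∀ {i m} → Chain i m → List (Instance σ × Instance σ)
  steps     (stop _)   = []
  steps {i} (step j c) = (i , Rule.apply (A j) i) ∷ steps c

  -- Some polynomial-time procedure applies the rules as long as possible and
  -- is a kernelization; moreover the size bound does not depend on the order
  -- in which the rules have been applied.
  record KernelizableVia (g : ℕ → ℕ) : Set where
    field
      kernel          : Instance σ → Instance σ
      isKernelization : IsKernelization L g kernel
      reaches         : ∀ i → ∃[ m ] Σ (Chain i m) λ c → end c ≡ kernel i
      anyOrder        : ∀ {i m} (c : Chain i m) → SizeAtMost L (g (proj₂ i)) (end c)

  NegativeChains : (Instance σ → ℕ) → Set
  NegativeChains C = ∀ i → Negative L i → Chain i (C i)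

  module _ (F : FregeSystem) (T : Translation L) where
    open Translation T

    SoundnessWitnessed : Kind → ∀ {C} → NegativeChains C → ℕ → (ℕ → ℕ) → Set
    SoundnessWitnessed κ chain R h =
      ∀ i (n : Negative L i) {a b} → (a , b) ∈ steps (chain i n) →
      StepSound F κ R (h ∣ Φ i ∣) (Φ a) (Φ b)

    SafetyWitnessed : Kind → ∀ {C} → NegativeChains C → (ℕ → ℕ) → Set
    SafetyWitnessed κ chain p =
      ∀ i (n : Negative L i) {a b} → (a , b) ∈ steps (chain i n) →
      Safe F κ (p ∣ Φ i ∣) (Φ a) (Φ b)

module _ {σ : ℕ} {L : ParamProblem σ} (T : Translation L) where
  open Translation T

  -- For fixed k, on negative instances: C(x,k) = O(g(|Φ(x,k)|)).
  LengthO : (Instance σ → ℕ) → ℕ → (ℕ → ℕ) → Set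
  LengthO C k g =
    Σ (ℕ → ℕ) λ f → (f =O g) ×
      (∀ x → Negative L (x , k) → C (x , k) ≤ f ∣ Φ (x , k) ∣)

  RefutableWithin : FregeSystem → Kind → ℕ → (ℕ → ℕ) → Set
  RefutableWithin F κ k f =
    ∀ x → Negative L (x , k) → Refutable F κ (Φ (x , k)) (f ∣ Φ (x , k) ∣)

{-# OPTIONS --safe #-}
module Submission where

open import Defs
open import Data.Bool using (Bool; true; false; _∧_)
open import Data.Bool.Properties using () renaming (_≟_ to _≟ᵇ_)
open import Data.Empty using (⊥-elim)
open import Data.Fin using (Fin)
open import Data.List using (List; []; _∷_; [_]; _++_; map; concatMap; length; sum; upTo; applyUpTo; replicate)
open import Data.List.Membership.Propositional using (_∈_; _∉_; find)
open import Data.List.Membership.Propositional.Properties using (∈-++⁺ˡ; ∈-++⁺ʳ; ∈-++⁻; ∈-map⁺; ∈-map⁻; ∈-concat⁺′; ∈-upTo⁺)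
open import Data.List.Properties using (length-++; length-map; length-replicate; map-cong; map-upTo)
open import Data.List.Relation.Binary.Subset.Propositional using (_⊆_)
open import Data.List.Relation.Binary.Subset.Propositional.Properties using (∈-∷⁺ʳ)
open import Data.List.Relation.Unary.All.Properties using (¬All⇒Any¬)
open import Data.List.Relation.Unary.Any using (here; there)
open import Data.Nat using (ℕ; zero; suc; _+_; _*_; _^_; _≤_; _<_; z≤n; s≤s; _≟_; _≤?_)
open import Data.Nat.Logarithm using (⌊log₂_⌋; ⌊log₂⌋-mono-≤; ⌊log₂[2^n]⌋≡n)
open import Data.Nat.Properties using (+-assoc; +-comm; +-identityʳ; +-mono-≤; +-monoˡ-≤; +-monoʳ-≤; *-distribˡ-+; *-distribʳ-+; *-identityʳ; *-zeroʳ; *-mono-≤; *-monoˡ-≤; *-monoʳ-≤; ^-monoʳ-≤; ^-monoˡ-≤; ^-distribˡ-+-*; m^n>0; m≤m+n; m≤n+m; m≤n⇒m≤o+n; n≤1+n; ≤-refl; ≤-reflexive; ≤-trans; ≰⇒>; <-irrefl; module ≤-Reasoning; +-suc; ^-*-assoc)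
open import Data.Nat.Solver using (module +-*-Solver)
open import Data.Product using (Σ; ∃-syntax; _×_; _,_; proj₁; proj₂)
open import Data.Sum using (_⊎_; inj₁; inj₂; [_,_]′)
open import Function using (_∘_; id; Equivalence)
open import Relation.Binary.PropositionalEquality using (_≡_; _≢_; refl; sym; trans; cong; cong₂; subst; module ≡-Reasoning)
open import Relation.Nullary using (¬_; Dec; yes; no; contradiction)
open import Data.List.Membership.DecPropositional _≟_ using (_∈?_)

-- Size counts lines, so replacing extension variables by their definitions
-- turns an extended Frege proof into a Frege proof with only a constant factor
-- more lines: q ↔ A becomes an instance of A ↔ A. Both parts then follow from
-- one argument. A refutation of a kernel by a truth table over its at most
-- poly(g(k)) variables is pulled back along the chain, where each witnessed
-- step substitutes the previous refutation under every case assumption; all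
-- lines stay conditional on a formula D collecting these assumptions, so that
-- the previous size is multiplied by R only.

-- Substitutions

-- Nothing is known about the axiom schemes of `F` beyond soundness and completeness, so
-- completeness is invoked only for ten fixed tautologies in three variables. Substituting into
-- their proofs gives every instance in the same number of lines, and all costs become multiples of
-- one constant `c` that depends on `F` alone. Extension variables are eliminated even where they
-- are allowed: the proofs for later steps are repeated in every case, and each repetition would
-- need variables fresh for all earlier lines. After the elimination only hypotheses, axioms and
-- modus ponens remain, so one construction yields refutations of either kind.

infixl 29 _⨾_

_⨾_ : Subst → Subst → Subst
(σ ⨾ τ) x = σ x ⟨ τ ⟩

⟨⟩-⨾ : ∀ A {σ τ} → A ⟨ σ ⟩ ⟨ τ ⟩ ≡ A ⟨ σ ⨾ τ ⟩
⟨⟩-⨾ (var x)  = refl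
⟨⟩-⨾ ⊥ᶠ       = refl
⟨⟩-⨾ (¬ᶠ A)   = cong ¬ᶠ_ (⟨⟩-⨾ A)
⟨⟩-⨾ (A ∧ᶠ B) = cong₂ _∧ᶠ_ (⟨⟩-⨾ A) (⟨⟩-⨾ B)
⟨⟩-⨾ (A ∨ᶠ B) = cong₂ _∨ᶠ_ (⟨⟩-⨾ A) (⟨⟩-⨾ B)
⟨⟩-⨾ (A ⇒ᶠ B) = cong₂ _⇒ᶠ_ (⟨⟩-⨾ A) (⟨⟩-⨾ B)

⟨⟩-cong : ∀ A {σ τ} → (∀ {x} → x ∈ vars A → σ x ≡ τ x) → A ⟨ σ ⟩ ≡ A ⟨ τ ⟩
⟨⟩-cong (var x)  e = e (here refl)
⟨⟩-cong ⊥ᶠ       e = refl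
⟨⟩-cong (¬ᶠ A)   e = cong ¬ᶠ_ (⟨⟩-cong A e)
⟨⟩-cong (A ∧ᶠ B) e = cong₂ _∧ᶠ_ (⟨⟩-cong A (e ∘ ∈-++⁺ˡ)) (⟨⟩-cong B (e ∘ ∈-++⁺ʳ (vars A)))
⟨⟩-cong (A ∨ᶠ B) e = cong₂ _∨ᶠ_ (⟨⟩-cong A (e ∘ ∈-++⁺ˡ)) (⟨⟩-cong B (e ∘ ∈-++⁺ʳ (vars A)))
⟨⟩-cong (A ⇒ᶠ B) e = cong₂ _⇒ᶠ_ (⟨⟩-cong A (e ∘ ∈-++⁺ˡ)) (⟨⟩-cong B (e ∘ ∈-++⁺ʳ (vars A)))

⟨var⟩ : ∀ A → A ⟨ var ⟩ ≡ A
⟨var⟩ (var x)  = refl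
⟨var⟩ ⊥ᶠ       = refl
⟨var⟩ (¬ᶠ A)   = cong ¬ᶠ_ (⟨var⟩ A)
⟨var⟩ (A ∧ᶠ B) = cong₂ _∧ᶠ_ (⟨var⟩ A) (⟨var⟩ B)
⟨var⟩ (A ∨ᶠ B) = cong₂ _∨ᶠ_ (⟨var⟩ A) (⟨var⟩ B)
⟨var⟩ (A ⇒ᶠ B) = cong₂ _⇒ᶠ_ (⟨var⟩ A) (⟨var⟩ B)

_[_≔_] : {B : Set} → (Var → B) → Var → B → Var → B
(f [ q ≔ b ]) x with x ≟ q
... | yes _ = b
... | no  _ = f x

≔-same : {B : Set} (f : Var → B) (q : Var) {b : B} → (f [ q ≔ b ]) q ≡ b
≔-same f q with q ≟ q
... | yes _   = refl
... | no  q≢q = contradiction refl q≢q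

≔-other : {B : Set} (f : Var → B) (q : Var) {b : B} {x : Var} → x ≢ q → (f [ q ≔ b ]) x ≡ f x
≔-other f q {x = x} x≢q with x ≟ q
... | yes x≡q = contradiction x≡q x≢q
... | no  _   = refl

⟨⟩-≔-fresh : ∀ A {θ q B} → q ∉ vars A → A ⟨ θ [ q ≔ B ] ⟩ ≡ A ⟨ θ ⟩
⟨⟩-≔-fresh A {θ} {q} q∉A = ⟨⟩-cong A λ x∈A → ≔-other θ q λ { refl → q∉A x∈A }

vars⊆varsOf : ∀ {A Γ} → A ∈ Γ → vars A ⊆ varsOf Γ
vars⊆varsOf A∈Γ x∈A = ∈-concat⁺′ x∈A (∈-map⁺ vars A∈Γ)

clauseFormula-rename : ∀ ρ C → clauseFormula (map (renameLiteral ρ) C) ≡ clauseFormula C ⟨ var ∘ ρ ⟩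
clauseFormula-rename ρ []          = refl
clauseFormula-rename ρ (pos x ∷ C) = cong (var (ρ x) ∨ᶠ_) (clauseFormula-rename ρ C)
clauseFormula-rename ρ (neg x ∷ C) = cong (¬ᶠ var (ρ x) ∨ᶠ_) (clauseFormula-rename ρ C)

clause-renamed : ∀ ρ Φ {A} → A ∈ clauses Φ → A ⟨ var ∘ ρ ⟩ ∈ clauses (rename ρ Φ)
clause-renamed ρ (C ∷ Φ) (here refl) = here (sym (clauseFormula-rename ρ C))
clause-renamed ρ (C ∷ Φ) (there A∈Φ) = there (clause-renamed ρ Φ A∈Φ)

-- Tautology schemes

⟪_,_,_⟫ : Formula → Formula → Formula → Subst
⟪ a , b , d ⟫ 0 = a
⟪ a , b , d ⟫ 1 = b
⟪ a , b , d ⟫ _ = d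

-- The metavariable `d` stands for the collected case assumptions. `constant` puts a line under
-- them, `distribute` is modus ponens under them, and `weaken`, `project` and `split` handle one
-- further conjunct.
data Scheme : Set where
  constant distribute weaken project split resolve⁺ resolve⁻ reflexive excluded verum : Scheme

scheme : Scheme → Formula
scheme s = formula s (var 0) (var 1) (var 2)
  where
  formula : Scheme → Formula → Formula → Formula → Formula
  formula constant   a b d = a ⇒ᶠ d ⇒ᶠ a
  formula distribute a b d = (d ⇒ᶠ a ⇒ᶠ b) ⇒ᶠ (d ⇒ᶠ a) ⇒ᶠ d ⇒ᶠ b
  formula weaken     a b d = (d ⇒ᶠ a) ⇒ᶠ d ∧ᶠ b ⇒ᶠ a
  formula project    a b d = d ∧ᶠ a ⇒ᶠ a
  formula split      a b d = (d ⇒ᶠ a ∨ᶠ b) ⇒ᶠ (d ∧ᶠ a ⇒ᶠ ⊥ᶠ) ⇒ᶠ d ⇒ᶠ b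
  formula resolve⁺   a b d = (d ⇒ᶠ a ∨ᶠ b) ⇒ᶠ (d ⇒ᶠ ¬ᶠ a) ⇒ᶠ d ⇒ᶠ b
  formula resolve⁻   a b d = (d ⇒ᶠ ¬ᶠ a ∨ᶠ b) ⇒ᶠ (d ⇒ᶠ a) ⇒ᶠ d ⇒ᶠ b
  formula reflexive  a b d = d ⇒ᶠ (a ⇔ᶠ a)
  -- The trailing `⊥ᶠ` is the end of a disjunction `⋁`, so that `splitCases` applies to the two
  -- truth values.
  formula excluded   a b d = d ⇒ᶠ a ∨ᶠ ¬ᶠ a ∨ᶠ ⊥ᶠ
  formula verum      a b d = ¬ᶠ ⊥ᶠ

inst : Scheme → Formula → Formula → Formula → Formula
inst s a b d = scheme s ⟨ ⟪ a , b , d ⟫ ⟩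

everywhere : (Bool → Bool) → Bool
everywhere f = f true ∧ f false

everywhere-sound : ∀ f → everywhere f ≡ true → ∀ b → f b ≡ true
everywhere-sound f e b with f true in eqᵗ | f false in eqᶠ
everywhere-sound f e true  | true | true = eqᵗ
everywhere-sound f e false | true | true = eqᶠ

truthTable : (Bool → Bool → Bool → Bool) → Bool
truthTable f = everywhere λ a → everywhere λ b → everywhere λ d → f a b d

truthTable-sound : ∀ f → truthTable f ≡ true → ∀ a b d → f a b d ≡ true
truthTable-sound f e a b d =
  everywhere-sound (f a b)
    (everywhere-sound (λ b → everywhere (f a b))
      (everywhere-sound (λ a → everywhere λ b → everywhere (f a b)) e a) b) d

assign : Bool → Bool → Bool → Valuation
assign a b d 0 = a
assign a b d 1 = b
assign a b d _ = d

-- Only the values at 0, 1 and 2 matter, which leaves eight rows to evaluate.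
scheme-valid : ∀ s → Tautology (scheme s)
scheme-valid s v = trans (local s) (truthTable-sound (λ a b d → truth (assign a b d) (scheme s)) (table s) _ _ _)
  where
  local : ∀ s → truth v (scheme s) ≡ truth (assign (v 0) (v 1) (v 2)) (scheme s)
  local constant   = refl
  local distribute = refl
  local weaken     = refl
  local project    = refl
  local split      = refl
  local resolve⁺   = refl
  local resolve⁻   = refl
  local reflexive  = refl
  local excluded   = refl
  local verum      = refl

  table : ∀ s → truthTable (λ a b d → truth (assign a b d) (scheme s)) ≡ true
  table constant   = refl
  table distribute = refl
  table weaken     = refl
  table project    = refl
  table split      = refl
  table resolve⁺   = refl
  table resolve⁻   = refl
  table reflexive  = refl
  table excluded   = refl
  table verum      = refl

schemesUsed : List Scheme
schemesUsed = constant ∷ distribute ∷ weaken ∷ project ∷ split ∷ resolve⁺ ∷ resolve⁻ ∷ reflexive ∷ excluded ∷ verum ∷ []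

used : ∀ s → s ∈ schemesUsed
used constant   = here refl
used distribute = there (here refl)
used weaken     = there (there (here refl))
used project    = there (there (there (here refl)))
used split      = there (there (there (there (here refl))))
used resolve⁺   = there (there (there (there (there (here refl)))))
used resolve⁻   = there (there (there (there (there (there (here refl))))))
used reflexive  = there (there (there (there (there (there (there (here refl)))))))
used excluded   = there (there (there (there (there (there (there (there (here refl))))))))
used verum      = there (there (there (there (there (there (there (there (there (here refl)))))))))

∈⇒≤sum : ∀ {B : Set} (f : B → ℕ) {x xs} → x ∈ xs → f x ≤ sum (map f xs)
∈⇒≤sum f (here refl)                = m≤m+n _ _
∈⇒≤sum f {xs = y ∷ _} (there x∈xs) = m≤n⇒m≤o+n (f y) (∈⇒≤sum f x∈xs)

-- Bounds on the size of refutations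

m≤2^m : ∀ m → m ≤ 2 ^ m
m≤2^m zero    = z≤n
m≤2^m (suc m) = begin
  1 + m              ≤⟨ +-mono-≤ (m^n>0 2 m) (m≤2^m m) ⟩
  2 ^ m + 2 ^ m      ≡⟨ cong (2 ^ m +_) (+-identityʳ _) ⟨
  2 ^ suc m          ∎
  where open ≤-Reasoning

sum-affine : ∀ {B : Set} (f : B → ℕ) k n bs →
             sum (map (λ b → n + f b * k) bs) ≡ sum (map f bs) * k + length bs * n
sum-affine f k n []       = refl
sum-affine f k n (b ∷ bs) = begin
  n + f b * k + sum (map (λ b → n + f b * k) bs)     ≡⟨ cong (n + f b * k +_) (sum-affine f k n bs) ⟩
  n + f b * k + (sum (map f bs) * k + length bs * n)
    ≡⟨ solve 5 (λ n x s l k → n :+ x :* k :+ (s :* k :+ l :* n) := (x :+ s) :* k :+ (n :+ l :* n))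
         refl n (f b) (sum (map f bs)) (length bs) k ⟩
  (f b + sum (map f bs)) * k + (n + length bs * n)   ∎
  where
  open ≡-Reasoning
  open +-*-Solver

length-cnfVars : ∀ Φ → length (cnfVars Φ) ≤ ∣ Φ ∣
length-cnfVars []      = z≤n
length-cnfVars (C ∷ Φ) = begin
  length (vars (clauseFormula C) ++ cnfVars Φ)          ≡⟨ length-++ (vars (clauseFormula C)) ⟩
  length (vars (clauseFormula C)) + length (cnfVars Φ)  ≡⟨ cong (_+ length (cnfVars Φ)) (clauseVars C) ⟩
  length C + length (cnfVars Φ)                         ≤⟨ +-mono-≤ (n≤1+n _) (length-cnfVars Φ) ⟩
  suc (length C) + ∣ Φ ∣                                ∎
  where
  open ≤-Reasoning
  clauseVars : ∀ C → length (vars (clauseFormula C)) ≡ length C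
  clauseVars []          = refl
  clauseVars (pos _ ∷ C) = cong suc (clauseVars C)
  clauseVars (neg _ ∷ C) = cong suc (clauseVars C)

falsified : ∀ Φ → ¬ Satisfiable Φ → ∀ v → ∃[ C ] C ∈ Φ × truth v (clauseFormula C) ≢ true
falsified Φ unsat v
  with A , A∈ , v⊭A ← find (¬All⇒Any¬ (λ A → truth v A ≟ᵇ true) (clauses Φ) (λ sat → unsat (v , sat)))
  with C , C∈ , refl ← ∈-map⁻ clauseFormula A∈ = C , C∈ , v⊭A

map-⊆ : ∀ {B : Set} {f : B → Formula} {bs As} → (∀ {b} → b ∈ bs → f b ∈ As) → map f bs ⊆ As
map-⊆ {f = f} f∈ A∈ with b , b∈ , refl ← ∈-map⁻ f A∈ = f∈ b∈

assigned : Bool → Var → Formula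
assigned true  x = var x
assigned false x = ¬ᶠ var x

-- Follows `refuteTree`: `n` counts the variables still to be branched on, `s` bounds the clause
-- length, and `w` is the price of citing a clause or an assumed literal. A branch raises `w` by
-- `c`, since citations must be weakened to the longer assumption. The sum over a list matches
-- `splitCases`.
tableCost : (c s n w : ℕ) → ℕ
tableCost c s zero    w = w + s * (c + w)
tableCost c s (suc n) w = c + sum (map (λ (_ : Bool) → c + tableCost c s n (c + w)) (true ∷ false ∷ []))

-- Each level adds `3 * c`, once for the excluded middle and once per branch; with the offset
-- `3 * c` the recurrence becomes plain doubling.
tableCost-closed : ∀ c s n w →
  tableCost c s n w + 3 * c ≡ 2 ^ n * (w + n * c + s * (c + (w + n * c)) + 3 * c)
tableCost-closed c s zero w =
  solve 3 (λ c s w → w :+ s :* (c :+ w) :+ con 3 :* c :=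
                     con 1 :* (w :+ con 0 :* c :+ s :* (c :+ (w :+ con 0 :* c)) :+ con 3 :* c)) refl c s w
  where open +-*-Solver
tableCost-closed c s (suc n) w = begin
  c + (c + t + (c + t + 0)) + 3 * c
    ≡⟨ solve 2 (λ c t → c :+ (c :+ t :+ (c :+ t :+ con 0)) :+ con 3 :* c := con 2 :* (t :+ con 3 :* c)) refl c t ⟩
  2 * (t + 3 * c)
    ≡⟨ cong (2 *_) (tableCost-closed c s n (c + w)) ⟩
  2 * (2 ^ n * (c + w + n * c + s * (c + (c + w + n * c)) + 3 * c))
    ≡⟨ solve 5 (λ c s n w e → con 2 :* (e :* (c :+ w :+ n :* c :+ s :* (c :+ (c :+ w :+ n :* c)) :+ con 3 :* c)) :=
          con 2 :* e :* (w :+ (c :+ n :* c) :+ s :* (c :+ (w :+ (c :+ n :* c))) :+ con 3 :* c)) refl c s n w (2 ^ n) ⟩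
  2 ^ suc n * (w + suc n * c + s * (c + (w + suc n * c)) + 3 * c) ∎
  where
  open ≡-Reasoning
  open +-*-Solver
  t : ℕ
  t = tableCost c s n (c + w)

tableCost-bound : ∀ c {n} s → n ≤ s → tableCost c s n c ≤ c * 2 ^ (s + 2 * (2 + s))
tableCost-bound c {n} s n≤s = begin
  tableCost c s n c
    ≤⟨ m≤m+n _ (3 * c) ⟩
  tableCost c s n c + 3 * c
    ≡⟨ tableCost-closed c s n c ⟩
  2 ^ n * (c + n * c + s * (c + (c + n * c)) + 3 * c)
    ≤⟨ *-mono-≤ (^-monoʳ-≤ 2 n≤s) (+-monoˡ-≤ (3 * c) (+-mono-≤ (+-monoʳ-≤ c nc≤sc) (*-monoʳ-≤ s (+-monoʳ-≤ c (+-monoʳ-≤ c nc≤sc))))) ⟩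
  2 ^ s * (c + s * c + s * (c + (c + s * c)) + 3 * c)
    -- The bracket is `c` times `4 + 3 * s + s * s`; one more `c * s` completes the square of
    -- `2 + s`.
    ≤⟨ m≤m+n _ (2 ^ s * (c * s)) ⟩
  2 ^ s * (c + s * c + s * (c + (c + s * c)) + 3 * c) + 2 ^ s * (c * s)
    ≡⟨ solve 3 (λ c s e → e :* (c :+ s :* c :+ s :* (c :+ (c :+ s :* c)) :+ con 3 :* c) :+ e :* (c :* s) :=
          c :* (e :* ((con 2 :+ s) :* (con 2 :+ s)))) refl c s (2 ^ s) ⟩
  c * (2 ^ s * ((2 + s) * (2 + s)))
    ≤⟨ *-monoʳ-≤ c (*-monoʳ-≤ (2 ^ s) (*-mono-≤ (m≤2^m (2 + s)) (m≤2^m (2 + s)))) ⟩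
  c * (2 ^ s * (2 ^ (2 + s) * 2 ^ (2 + s)))
    ≡⟨ cong (λ e → c * (2 ^ s * e)) (^-distribˡ-+-* 2 (2 + s) (2 + s)) ⟨
  c * (2 ^ s * 2 ^ (2 + s + (2 + s)))
    ≡⟨ cong (c *_) (^-distribˡ-+-* 2 s (2 + s + (2 + s))) ⟨
  c * 2 ^ (s + (2 + s + (2 + s)))
    ≡⟨ cong (λ e → c * 2 ^ (s + (2 + s + e))) (+-identityʳ (2 + s)) ⟨
  c * 2 ^ (s + 2 * (2 + s)) ∎
  where
  open ≤-Reasoning
  open +-*-Solver
  nc≤sc : n * c ≤ s * c
  nc≤sc = *-monoˡ-≤ c n≤s

-- Derivations counted in lines

module Constant (F : FregeSystem) where

  open FregeSystem F

  schemeProof : (s : Scheme) → Derivation schemes frege [] [ scheme s ]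
  schemeProof s = complete (scheme-valid s)

  schemeSize : Scheme → ℕ
  schemeSize s = Derivation.size (schemeProof s)

  abstract
    c : ℕ
    c = 2 + sum (map schemeSize schemesUsed)

    -- The `2` leaves room for two applications of modus ponens to an instance of a scheme, as in
    -- `rule₂`.
    schemeSize≤c : ∀ s → 2 + schemeSize s ≤ c
    schemeSize≤c s = +-monoʳ-≤ 2 (∈⇒≤sum schemeSize (used s))

  1≤c : 1 ≤ c
  1≤c = ≤-trans (s≤s z≤n) (schemeSize≤c verum)

  -- The budget for one line of a witness: `2 * c` for a hypothesis, which may have to be weakened
  -- to a further case assumption, and `3 * c`, which covers every other kind of line.
  perLine : ℕ
  perLine = 2 * c + 3 * c

module Derivability (F : FregeSystem) (κ : Kind) (Γ Δ : List Formula) where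

  open FregeSystem F
  open Constant F

  record Extension (ls : List Formula) (n : ℕ) (As : List Formula) : Set where
    constructor extension
    field
      {lines} : List Formula
      proof   : Proof schemes κ Γ Δ lines
      keeps   : ls ⊆ lines
      reaches : As ⊆ lines
      cost    : length lines ≤ n + length ls

  infix 4 _⊢[_]_

  -- Quantifying over all proofs that contain Hs lets entailments be composed
  -- with their sizes added and shared lines counted once.
  record _⊢[_]_ (Hs : List Formula) (n : ℕ) (As : List Formula) : Set where
    constructor entailment
    field
      extend : ∀ {ls} → Proof schemes κ Γ Δ ls → Hs ⊆ ls → Extension ls n As

  open _⊢[_]_

  weakenˡ : ∀ {Hs Hs′ n As} → Hs ⊆ Hs′ → Hs ⊢[ n ] As → Hs′ ⊢[ n ] As
  weakenˡ Hs⊆ d .extend P ⊆ls = extend d P (⊆ls ∘ Hs⊆)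

  weakenʳ : ∀ {Hs n As Bs} → Bs ⊆ As → Hs ⊢[ n ] As → Hs ⊢[ n ] Bs
  weakenʳ Bs⊆ d .extend P ⊆ls =
    let extension P′ k r c = extend d P ⊆ls in extension P′ k (r ∘ Bs⊆) c

  relax : ∀ {Hs m n As} → m ≤ n → Hs ⊢[ m ] As → Hs ⊢[ n ] As
  relax m≤n d .extend P ⊆ls =
    let extension P′ k r c = extend d P ⊆ls
    in extension P′ k r (≤-trans c (+-monoˡ-≤ _ m≤n))

  available : ∀ {Hs n As} → As ⊆ Hs → Hs ⊢[ n ] As
  available {n = n} As⊆ .extend P ⊆ls = extension P id (⊆ls ∘ As⊆) (m≤n+m _ n)

  infixr 5 _⨟_

  _⨟_ : ∀ {Hs m n As Bs} → Hs ⊢[ m ] As → As ++ Hs ⊢[ n ] Bs → Hs ⊢[ n + m ] As ++ Bs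
  _⨟_ {m = m} {n} {As} d e .extend {ls} P ⊆ls
    with extension {lines₁} P₁ k₁ r₁ c₁ ← extend d P ⊆ls
    with extension {lines₂} P₂ k₂ r₂ c₂ ← extend e P₁ ([ r₁ , k₁ ∘ ⊆ls ]′ ∘ ∈-++⁻ As)
    = extension P₂ (k₂ ∘ k₁) ([ k₂ ∘ r₁ , r₂ ]′ ∘ ∈-++⁻ As)
      (begin
        length lines₂            ≤⟨ c₂ ⟩
        n + length lines₁        ≤⟨ +-monoʳ-≤ n c₁ ⟩
        n + (m + length ls)      ≡⟨ +-assoc n m _ ⟨
        n + m + length ls        ∎)
    where open ≤-Reasoning

  infixr 5 _then_

  _then_ : ∀ {Hs m n As Bs} → Hs ⊢[ m ] As → As ++ Hs ⊢[ n ] Bs → Hs ⊢[ n + m ] Bs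
  _then_ {As = As} d e = weakenʳ (∈-++⁺ʳ As) (d ⨟ e)

  hypothesis : ∀ {Hs A} → A ∈ Γ → Hs ⊢[ 1 ] [ A ]
  hypothesis A∈Γ .extend P ⊆ls = extension (hyp A∈Γ P) there (λ { (here refl) → here refl }) ≤-refl

  axiomInstance : ∀ {Hs S} → S ∈ schemes → (σ : Subst) → Hs ⊢[ 1 ] [ S ⟨ σ ⟩ ]
  axiomInstance S∈ σ .extend P ⊆ls = extension (ax S∈ σ P) there (λ { (here refl) → here refl }) ≤-refl

  modusPonens : ∀ {Hs A B} → A ∈ Hs → (A ⇒ᶠ B) ∈ Hs → Hs ⊢[ 1 ] [ B ]
  modusPonens A∈ A⇒B∈ .extend P ⊆ls =
    extension (mp (⊆ls A∈) (⊆ls A⇒B∈) P) there (λ { (here refl) → here refl }) ≤-refl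

  -- Instances of schemes are closed under substitution, hence so are proofs without hypotheses. The
  -- number of lines does not depend on the formulas substituted.
  replay : ∀ {Hs Δ′ ls} (σ : Subst) → Proof schemes frege [] Δ′ ls → Hs ⊢[ length ls ] map (_⟨ σ ⟩) ls
  replay σ done = available λ ()
  replay σ (ax {S = S} S∈ ρ P) =
    weakenʳ (∈-∷⁺ʳ (∈-++⁺ʳ _ (here (⟨⟩-⨾ S))) ∈-++⁺ˡ)
      (replay σ P ⨟ axiomInstance S∈ (ρ ⨾ σ))
  replay σ (mp A∈ A⇒B∈ P) =
    weakenʳ (∈-∷⁺ʳ (∈-++⁺ʳ _ (here refl)) ∈-++⁺ˡ)
      (replay σ P ⨟ modusPonens (∈-++⁺ˡ (∈-map⁺ _ A∈)) (∈-++⁺ˡ (∈-map⁺ _ A⇒B∈)))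

  schemeInstance : ∀ {Hs} s {a b d} → Hs ⊢[ schemeSize s ] [ inst s a b d ]
  schemeInstance s {a} {b} {d} =
    weakenʳ (λ { (here refl) → ∈-map⁺ _ (Derivation.concludes (schemeProof s) (here refl)) })
      (replay ⟪ a , b , d ⟫ (Derivation.proof (schemeProof s)))

  ≡-⊢ : ∀ {Hs n A B} → A ≡ B → Hs ⊢[ n ] [ A ] → Hs ⊢[ n ] [ B ]
  ≡-⊢ refl d = d

  rule₀ : ∀ {Hs} s {a b d} → Hs ⊢[ c ] [ inst s a b d ]
  rule₀ s = relax (≤-trans (m≤n+m _ 2) (schemeSize≤c s)) (schemeInstance s)

  detach : ∀ {Hs m n A B} → Hs ⊢[ m ] [ A ] → Hs ⊢[ n ] [ A ⇒ᶠ B ] → Hs ⊢[ suc n + m ] [ B ]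
  detach d e = d then (weakenˡ there e then modusPonens (there (here refl)) (here refl))

  rule₁ : ∀ {Hs m A B} s a b d → inst s a b d ≡ A ⇒ᶠ B →
          Hs ⊢[ m ] [ A ] → Hs ⊢[ c + m ] [ B ]
  rule₁ {Hs} {m} s a b d e dA =
    relax (+-monoˡ-≤ m (≤-trans (n≤1+n _) (schemeSize≤c s)))
      (detach dA (≡-⊢ e (schemeInstance s)))

  rule₂ : ∀ {Hs m n A B C} s a b d → inst s a b d ≡ A ⇒ᶠ B ⇒ᶠ C →
          Hs ⊢[ m ] [ A ] → Hs ⊢[ n ] [ B ] → Hs ⊢[ c + m + n ] [ C ]
  rule₂ {Hs} {m} {n} s a b d e dA dB =
    relax (+-monoˡ-≤ n (+-monoˡ-≤ m (schemeSize≤c s)))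
      (detach dB (detach dA (≡-⊢ e (schemeInstance s))))

  prepend : ∀ {Hs m n A As} → Hs ⊢[ m ] As → As ++ Hs ⊢[ n ] [ A ] → Hs ⊢[ n + m ] A ∷ As
  prepend {As = As} d e = weakenʳ (∈-∷⁺ʳ (∈-++⁺ʳ As (here refl)) ∈-++⁺ˡ) (d ⨟ e)

  c≤_+3*c : ∀ b → c ≤ b + 3 * c
  c≤ b +3*c = m≤n⇒m≤o+n b (m≤m+n c _)

  -- Elimination of extension variables

  definitions : ∀ {κ′ Γ′ Δ′ ls} → Proof schemes κ′ Γ′ Δ′ ls → Subst
  definitions done         = var
  definitions (hyp _ P)    = definitions P
  definitions (ax _ _ P)   = definitions P
  definitions (mp _ _ P)   = definitions P
  -- `A` may contain older extension variables, so they are expanded before `q` is bound to it.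
  definitions (ext q A _ P) = definitions P [ q ≔ A ⟨ definitions P ⟩ ]

  -- No extension variable occurs in a hypothesis or an intended conclusion, so the expansion
  -- returns the conclusions in their original form.
  definitions-fix : ∀ {κ′ Γ′ Δ′ ls A} (P : Proof schemes κ′ Γ′ Δ′ ls) →
                    A ∈ Γ′ ++ Δ′ → A ⟨ definitions P ⟩ ≡ A
  definitions-fix {A = A} done _  = ⟨var⟩ A
  definitions-fix (hyp _ P)       = definitions-fix P
  definitions-fix (ax _ _ P)      = definitions-fix P
  definitions-fix (mp _ _ P)      = definitions-fix P
  definitions-fix {A = B} (ext {ls = ls} q A q∉ P) B∈ =
    trans (⟨⟩-≔-fresh B (q∉ ∘ vars⊆varsOf {Γ = A ∷ _} (there (∈-++⁺ʳ ls B∈)))) (definitions-fix P B∈)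

  -- The deduction theorem for the assumption `D` and the expansion of definitions, carried out in a
  -- single pass over the lines.
  unfold : ∀ {κ′ Γ′ Δ′ ls Hs b} (P : Proof schemes κ′ Γ′ Δ′ ls) D τ →
           (∀ {A} → A ∈ Γ′ → Hs ⊢[ b ] [ D ⇒ᶠ A ⟨ τ ⟩ ]) →
           Hs ⊢[ length ls * (b + 3 * c) ] map (λ B → D ⇒ᶠ B ⟨ definitions P ⟩ ⟨ τ ⟩) ls
  unfold done D τ _ = available λ ()
  unfold {b = b} (hyp A∈ P) D τ given =
    prepend (unfold P D τ given)
      (weakenˡ (∈-++⁺ʳ _) (relax (m≤m+n b _)
        (≡-⊢ (cong (λ B → D ⇒ᶠ B ⟨ τ ⟩) (sym (definitions-fix P (∈-++⁺ˡ A∈)))) (given A∈))))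
  unfold {b = b} (ax {S = S} S∈ σ P) D τ given =
    prepend (unfold P D τ given)
      (relax (m≤n⇒m≤o+n b (+-monoʳ-≤ c (≤-trans 1≤c (m≤m+n c _))))
        (rule₁ constant _ ⊥ᶠ D refl
          (≡-⊢ (sym (trans (cong (_⟨ τ ⟩) (⟨⟩-⨾ S)) (⟨⟩-⨾ S))) (axiomInstance S∈ _))))
  unfold {b = b} (mp {A = A} {B} A∈ A⇒B∈ P) D τ given =
    prepend (unfold P D τ given)
      (relax (≤-trans (≤-reflexive (trans (+-identityʳ _) (+-identityʳ c))) c≤ b +3*c)
        (rule₂ {m = 0} {0} distribute (A ⟨ definitions P ⟩ ⟨ τ ⟩) (B ⟨ definitions P ⟩ ⟨ τ ⟩) D refl
          (available λ { (here refl) → ∈-++⁺ˡ (∈-map⁺ _ A⇒B∈) })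
          (available λ { (here refl) → ∈-++⁺ˡ (∈-map⁺ _ A∈) })))
  unfold {Hs = Hs} {b} (ext {ls = ls} q A q∉ P) D τ given =
    prepend (subst (Hs ⊢[ _ ]_) (map-fresh ls id) (unfold P D τ given))
      (relax c≤ b +3*c
        (≡-⊢ (cong (λ I → D ⇒ᶠ I ⟨ τ ⟩) (sym unfolded)) (rule₀ reflexive {b = ⊥ᶠ})))
    where
    θ₀ θ₁ : Subst
    θ₀ = definitions P
    θ₁ = θ₀ [ q ≔ A ⟨ θ₀ ⟩ ]

    unfolded : (var q ⇔ᶠ A) ⟨ θ₁ ⟩ ≡ (A ⟨ θ₀ ⟩ ⇔ᶠ A ⟨ θ₀ ⟩)
    unfolded = cong₂ _⇔ᶠ_ (≔-same θ₀ q) (⟨⟩-≔-fresh A (q∉ ∘ ∈-++⁺ˡ))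

    -- Binding `q` changes the substitution for the whole proof, but the older lines do not contain
    -- `q`.
    map-fresh : ∀ ks → ks ⊆ ls →
                map (λ B → D ⇒ᶠ B ⟨ θ₀ ⟩ ⟨ τ ⟩) ks ≡ map (λ B → D ⇒ᶠ B ⟨ θ₁ ⟩ ⟨ τ ⟩) ks
    map-fresh []       _  = refl
    map-fresh (B ∷ ks) ⊆l = cong₂ _∷_
      (cong (λ B′ → D ⇒ᶠ B′ ⟨ τ ⟩)
        (sym (⟨⟩-≔-fresh B (q∉ ∘ vars⊆varsOf {Γ = A ∷ _} (there (∈-++⁺ˡ (⊆l (here refl))))))))
      (map-fresh ks (⊆l ∘ there))

  -- Witnesses and reduction steps under an assumption

  under : Formula → Subst → List Formula → List Formula
  under D τ = map (λ B → D ⇒ᶠ B ⟨ τ ⟩)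

  conclude : ∀ {κ′ Γ′ Δ′ Hs} (d : Derivation schemes κ′ Γ′ Δ′) D τ →
             (∀ {A} → A ∈ Γ′ → Hs ⊢[ 2 * c ] [ D ⇒ᶠ A ⟨ τ ⟩ ]) →
             Hs ⊢[ Derivation.size d * perLine ] under D τ Δ′
  conclude {Γ′ = Γ′} d D τ given = 
    weakenʳ
      (map-⊆ λ A∈Δ′ → subst (λ A → (D ⇒ᶠ A ⟨ τ ⟩) ∈ map line lines)
                         (definitions-fix proof (∈-++⁺ʳ Γ′ A∈Δ′))
                         (∈-map⁺ line (concludes A∈Δ′)))
      (unfold proof D τ given)
    where
    open Derivation d
    line : Formula → Formula
    line B = D ⇒ᶠ B ⟨ definitions proof ⟩ ⟨ τ ⟩

  -- From here on both kinds of witness look alike: the clauses of `η` arise with the witnessing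
  -- substitution applied. In the extended case disjointness allows `τ` to be changed on the
  -- variables of `η` without disturbing `Γ′`.
  transfer : ∀ κ′ {Γ′ η Hs} (w : Witness F κ′ Γ′ η) D τ →
             (∀ {A} → A ∈ Γ′ → Hs ⊢[ 2 * c ] [ D ⇒ᶠ A ⟨ τ ⟩ ]) →
             Hs ⊢[ Witness.size w * perLine ] under D (Witness.σ w ⨾ τ) (clauses η)
  transfer frege w D τ given = 
    weakenʳ
      (map-⊆ λ {A} A∈ → subst (λ B → (D ⇒ᶠ B) ∈ under D τ _) (⟨⟩-⨾ A) (∈-map⁺ _ (∈-map⁺ (_⟨ σ ⟩) A∈)))
      (conclude proof D τ given)
    where open Witness w
  transfer extended {Γ′} {η} {Hs} w D τ given = 
    weakenʳ
      (map-⊆ λ {A} A∈ → subst (λ B → (D ⇒ᶠ B) ∈ under D τ₁ _)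
                          (⟨⟩-cong A (inside ∘ vars⊆varsOf A∈))
                          (∈-map⁺ _ A∈))
      (conclude proof D τ₁ given₁)
    where
    open Witness w

    -- y ↦ σ y on the variables of η, so that each hypothesis y ↔ σ y becomes
    -- an instance of A ↔ A.
    τ₁ : Subst
    τ₁ y with y ∈? cnfVars η
    ... | yes _ = σ y ⟨ τ ⟩
    ... | no  _ = τ y

    inside : ∀ {y} → y ∈ cnfVars η → τ₁ y ≡ σ y ⟨ τ ⟩
    inside {y} y∈ with y ∈? cnfVars η
    ... | yes _ = refl
    ... | no y∉ = contradiction y∈ y∉

    outside : ∀ {y} → y ∈ varsOf Γ′ → τ₁ y ≡ τ y
    outside {y} y∈ with y ∈? cnfVars η
    ... | yes y∈η = contradiction (y∈ , y∈η) disjoint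
    ... | no  _   = refl

    given₁ : ∀ {A} → A ∈ Γ′ ++ map (λ y → var y ⇔ᶠ σ y) (cnfVars η) → Hs ⊢[ 2 * c ] [ D ⇒ᶠ A ⟨ τ₁ ⟩ ]
    given₁ {A} A∈ with ∈-++⁻ Γ′ A∈
    ... | inj₁ A∈Γ′ = ≡-⊢ (cong (D ⇒ᶠ_) (sym (⟨⟩-cong A (outside ∘ vars⊆varsOf A∈Γ′)))) (given A∈Γ′)
    -- By `over` and disjointness no variable of `η` occurs in `σ y`; hence `τ₁` acts on it as `τ`
    -- does, and both sides of the equivalence agree.
    ... | inj₂ A∈≔ with y , y∈ , refl ← ∈-map⁻ (λ y → var y ⇔ᶠ σ y) A∈≔ =
      ≡-⊢ (cong (D ⇒ᶠ_) (sym (cong₂ _⇔ᶠ_ (inside y∈) (⟨⟩-cong (σ y) (outside ∘ over y∈)))))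
        (relax (m≤m+n c _) (rule₀ reflexive {b = ⊥ᶠ}))

  -- Quantifying over D avoids paying the constant factor of the deduction
  -- theorem again at each step of a chain.
  Refutes : CNF → ℕ → Set
  Refutes Φ n = ∀ {Hs} D τ → (∀ {A} → A ∈ clauses Φ → Hs ⊢[ c ] [ D ⇒ᶠ A ⟨ τ ⟩ ]) →
                Hs ⊢[ n ] [ D ⇒ᶠ ⊥ᶠ ]

  -- A renaming followed by the witnessing substitution is again a substitution, and `Refutes`
  -- covers all of them; so the refutation of `Φ′` applies to its copy at the same cost.
  refuteCopy : ∀ {κ′ Γ′ η Φ′ n Hs} → IsRenamingOf η Φ′ → Refutes Φ′ n → (w : Witness F κ′ Γ′ η) → ∀ D τ →
               (∀ {A} → A ∈ Γ′ → Hs ⊢[ 2 * c ] [ D ⇒ᶠ A ⟨ τ ⟩ ]) →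
               Hs ⊢[ n + Witness.size w * perLine ] [ D ⇒ᶠ ⊥ᶠ ]
  refuteCopy {κ′} {Φ′ = Φ′} record { ρ = ρ ; renamed = refl } refutes w D τ given =
    transfer κ′ w D τ given then
    refutes D ((var ∘ ρ) ⨾ τ′) λ {A} A∈ → available λ where
      (here refl) → ∈-++⁺ˡ (subst (λ B → (D ⇒ᶠ B) ∈ under D τ′ (clauses (rename ρ Φ′))) (⟨⟩-⨾ A)
                               (∈-map⁺ _ (clause-renamed ρ Φ′ A∈)))
    where
    τ′ : Subst
    τ′ = Witness.σ w ⨾ τ

  -- Each use of `split` discards the first disjunct. What remains after the last one is the empty
  -- disjunction, `⊥ᶠ`.
  splitCases : ∀ {B : Set} (Ξ : B → Formula) (cost : B → ℕ) {Hs m D τ} bs →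
               (∀ b → Hs ⊢[ cost b ] [ D ∧ᶠ Ξ b ⟨ τ ⟩ ⇒ᶠ ⊥ᶠ ]) →
               Hs ⊢[ m ] [ D ⇒ᶠ ⋁ (map Ξ bs) ⟨ τ ⟩ ] →
               Hs ⊢[ m + sum (map (λ b → c + cost b) bs) ] [ D ⇒ᶠ ⊥ᶠ ]
  splitCases Ξ cost {m = m} [] refuted d = relax (≤-reflexive (sym (+-identityʳ m))) d
  splitCases Ξ cost {m = m} (b ∷ bs) refuted d =
    relax (≤-reflexive (solve 4 (λ c m k s → c :+ m :+ k :+ s := m :+ (c :+ k :+ s)) refl
                          c m (cost b) (sum (map (λ b → c + cost b) bs))))
      (splitCases Ξ cost bs refuted (rule₂ split _ _ _ refl d (refuted b)))
    where open +-*-Solver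

  -- The budget `s` pays for the disjunction and all witnesses together. Only the refutation of `Φ′`
  -- is repeated, once per case, so `R` multiplies `n` but not `s`.
  refuteStep : ∀ {κ′ R s Φ Φ′ n} → StepSound F κ′ R s Φ Φ′ → Refutes Φ′ n →
               Refutes Φ (s * perLine + R * (c + n))
  refuteStep {κ′} {R} {s} {Φ} {Φ′} {n} sound refutes D τ given =
    relax bounded
      (splitCases Case.Ξ (λ C → n + caseSize C * perLine) cases refuteCase
        (conclude derivation D τ λ ()))
    where
    open StepSound sound

    caseSize : Case F κ′ Φ Φ′ → ℕ
    caseSize C = Witness.size (Case.witness C)

    refuteCase : ∀ C → _ ⊢[ n + caseSize C * perLine ] [ D ∧ᶠ Case.Ξ C ⟨ τ ⟩ ⇒ᶠ ⊥ᶠ ]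
    refuteCase C = refuteCopy copy refutes witness (D ∧ᶠ Ξ ⟨ τ ⟩) τ λ A∈ → case (∈-++⁻ (clauses Φ) A∈)
      where
      open Case C
      case : ∀ {A} → A ∈ clauses Φ ⊎ A ∈ [ Ξ ] → _ ⊢[ 2 * c ] [ D ∧ᶠ Ξ ⟨ τ ⟩ ⇒ᶠ A ⟨ τ ⟩ ]
      case (inj₁ A∈Φ) = relax (≤-reflexive (cong (c +_) (sym (+-identityʳ c)))) (rule₁ weaken _ _ _ refl (given A∈Φ))
      case (inj₂ (here refl)) = relax (m≤m+n c _) (rule₀ project {b = ⊥ᶠ})

    bounded : Derivation.size derivation * perLine + sum (map (λ C → c + (n + caseSize C * perLine)) cases)
              ≤ s * perLine + R * (c + n)
    bounded = begin
      d * perLine + sum (map (λ C → c + (n + caseSize C * perLine)) cases)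
        ≡⟨ cong (λ ns → d * perLine + sum ns) (map-cong (λ C → sym (+-assoc c n _)) cases) ⟩
      d * perLine + sum (map (λ C → c + n + caseSize C * perLine) cases)
        ≡⟨ cong (d * perLine +_) (sum-affine caseSize perLine (c + n) cases) ⟩
      d * perLine + (sum (map caseSize cases) * perLine + length cases * (c + n))
        ≡⟨ +-assoc (d * perLine) _ _ ⟨
      d * perLine + sum (map caseSize cases) * perLine + length cases * (c + n)
        ≡⟨ cong (_+ length cases * (c + n)) (*-distribʳ-+ perLine d _) ⟨
      (d + sum (map caseSize cases)) * perLine + length cases * (c + n)
        ≤⟨ +-mono-≤ (*-monoˡ-≤ perLine total) (*-monoˡ-≤ (c + n) bound) ⟩
      s * perLine + R * (c + n) ∎
      where
      open ≤-Reasoning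
      d : ℕ
      d = Derivation.size derivation

  -- The bound is padded to that of a step with a single case, so that both parts of the theorem
  -- share one chain estimate.
  refuteSafe : ∀ {κ′ s Φ Φ′ n} → Safe F κ′ s Φ Φ′ → Refutes Φ′ n → Refutes Φ (s * perLine + 1 * (c + n))
  refuteSafe {s = s} {n = n} (η , copy , w , w≤s) refutes D τ given =
    relax bounded (refuteCopy copy refutes w D τ λ A∈ → relax (m≤m+n c _) (given A∈))
    where
    open ≤-Reasoning
    bounded : n + Witness.size w * perLine ≤ s * perLine + 1 * (c + n)
    bounded = begin
      n + Witness.size w * perLine  ≤⟨ +-mono-≤ (≤-trans (m≤n+m n c) (m≤m+n (c + n) 0)) (*-monoˡ-≤ perLine w≤s) ⟩
      1 * (c + n) + s * perLine     ≡⟨ +-comm (1 * (c + n)) _ ⟩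
      s * perLine + 1 * (c + n)     ∎

  -- Truth table refutations

  refuteClause : ∀ {Hs v D τ w m} C → truth v (clauseFormula C) ≢ true →
                 (∀ {x} → x ∈ vars (clauseFormula C) → Hs ⊢[ w ] [ D ⇒ᶠ assigned (v x) x ⟨ τ ⟩ ]) →
                 Hs ⊢[ m ] [ D ⇒ᶠ clauseFormula C ⟨ τ ⟩ ] →
                 Hs ⊢[ m + length C * (c + w) ] [ D ⇒ᶠ ⊥ᶠ ]
  -- Once every literal has been resolved away, the clause is the empty disjunction and the line
  -- reads `D ⇒ᶠ ⊥ᶠ`.
  refuteClause {m = m} [] _ _ d = relax (≤-reflexive (sym (+-identityʳ m))) d
  refuteClause {v = v} {w = w} {m} (pos x ∷ C) ⊭C values d with v x in vx | values (here refl)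
  ... | true  | _  = contradiction refl ⊭C
  ... | false | ¬x =
    relax (≤-reflexive (solve 4 (λ c m w k → c :+ m :+ w :+ k := m :+ (c :+ w :+ k)) refl c m w (length C * (c + w))))
      (refuteClause {v = v} C ⊭C (values ∘ there) (rule₂ resolve⁺ _ _ _ refl d ¬x))
    where open +-*-Solver
  refuteClause {v = v} {w = w} {m} (neg x ∷ C) ⊭C values d with v x in vx | values (here refl)
  ... | false | _  = contradiction refl ⊭C
  ... | true  | x′ =
    relax (≤-reflexive (solve 4 (λ c m w k → c :+ m :+ w :+ k := m :+ (c :+ w :+ k)) refl c m w (length C * (c + w))))
      (refuteClause {v = v} C ⊭C (values ∘ there) (rule₂ resolve⁻ _ _ _ refl d x′))
    where open +-*-Solver

  -- cnfVars may list a variable twice: the later branch overwrites its value.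
  refuteTree : ∀ {Hs Φ} → ¬ Satisfiable Φ → ∀ xs v D τ w →
               (∀ {x} → x ∈ cnfVars Φ → x ∈ xs ⊎ Hs ⊢[ w ] [ D ⇒ᶠ assigned (v x) x ⟨ τ ⟩ ]) →
               (∀ {A} → A ∈ clauses Φ → Hs ⊢[ w ] [ D ⇒ᶠ A ⟨ τ ⟩ ]) →
               Hs ⊢[ tableCost c ∣ Φ ∣ (length xs) w ] [ D ⇒ᶠ ⊥ᶠ ]
  refuteTree {Φ = Φ} unsat [] v D τ w values given
    with C , C∈Φ , ⊭C ← falsified Φ unsat v =
    relax (+-monoʳ-≤ w (*-monoˡ-≤ (c + w) (≤-trans (n≤1+n _) (∈⇒≤sum (λ C → suc (length C)) C∈Φ))))
      (refuteClause {v = v} C ⊭C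
        (λ x∈C → [ (λ ()) , id ]′ (values (vars⊆varsOf (∈-map⁺ clauseFormula C∈Φ) x∈C)))
        (given (∈-map⁺ clauseFormula C∈Φ)))
  refuteTree {Hs} {Φ} unsat (x ∷ xs) v D τ w values given =
    splitCases (λ b → assigned b x) (λ _ → tableCost c ∣ Φ ∣ (length xs) (c + w)) (true ∷ false ∷ [])
      (λ b → refuteTree unsat xs (v [ x ≔ b ]) (D ∧ᶠ assigned b x ⟨ τ ⟩) τ (c + w)
        (values′ b) (λ A∈ → rule₁ weaken _ _ _ refl (given A∈)))
      (rule₀ excluded {b = ⊥ᶠ})
    where
    new : ∀ b {y} → y ≡ x → Hs ⊢[ c + w ] [ D ∧ᶠ assigned b x ⟨ τ ⟩ ⇒ᶠ assigned ((v [ x ≔ b ]) y) y ⟨ τ ⟩ ]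
    new b refl = ≡-⊢ (cong (λ a → D ∧ᶠ assigned b x ⟨ τ ⟩ ⇒ᶠ assigned a x ⟨ τ ⟩) (sym (≔-same v x)))
                   (relax (m≤m+n c w) (rule₀ project {b = ⊥ᶠ}))

    values′ : ∀ b {y} → y ∈ cnfVars Φ →
              y ∈ xs ⊎ Hs ⊢[ c + w ] [ D ∧ᶠ assigned b x ⟨ τ ⟩ ⇒ᶠ assigned ((v [ x ≔ b ]) y) y ⟨ τ ⟩ ]
    values′ b {y} y∈ = update (values y∈) (y ≟ x)
      where
      update : y ∈ x ∷ xs ⊎ Hs ⊢[ w ] [ D ⇒ᶠ assigned (v y) y ⟨ τ ⟩ ] → Dec (y ≡ x) →
               y ∈ xs ⊎ Hs ⊢[ c + w ] [ D ∧ᶠ assigned b x ⟨ τ ⟩ ⇒ᶠ assigned ((v [ x ≔ b ]) y) y ⟨ τ ⟩ ]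
      update (inj₁ (there y∈xs)) _         = inj₁ y∈xs
      update (inj₁ (here y≡x))   _         = inj₂ (new b y≡x)
      update (inj₂ _)            (yes y≡x) = inj₂ (new b y≡x)
      update (inj₂ d)            (no y≢x)  =
        inj₂ (≡-⊢ (cong (λ a → D ∧ᶠ assigned b x ⟨ τ ⟩ ⇒ᶠ assigned a y ⟨ τ ⟩) (sym (≔-other v x y≢x)))
               (rule₁ weaken _ _ _ refl d))

  refuteUnsatisfiable : ∀ {Φ} → ¬ Satisfiable Φ → Refutes Φ (c * 2 ^ (∣ Φ ∣ + 2 * (2 + ∣ Φ ∣)))
  refuteUnsatisfiable {Φ} unsat D τ given =
    relax (tableCost-bound c ∣ Φ ∣ (length-cnfVars Φ))
      -- The initial valuation is a placeholder: every variable of `Φ` is still to be branched on.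
      (refuteTree unsat (cnfVars Φ) (λ _ → true) D τ c inj₁ given)

-- Polynomials

infixl 6 _⊕_
infixl 7 _⊗_ _·_

_⊕_ : Poly → Poly → Poly
[]      ⊕ q       = q
(a ∷ p) ⊕ []      = a ∷ p
(a ∷ p) ⊕ (b ∷ q) = a + b ∷ p ⊕ q

_·_ : ℕ → Poly → Poly
k · p = map (k *_) p

_⊗_ : Poly → Poly → Poly
[]      ⊗ q = []
(a ∷ p) ⊗ q = a · q ⊕ (0 ∷ p ⊗ q)

_⊙_ : Poly → Poly → Poly
[]      ⊙ q = []
(a ∷ p) ⊙ q = [ a ] ⊕ q ⊗ (p ⊙ q)

module _ (n : ℕ) where

  open ≡-Reasoning
  open +-*-Solver

  eval-constant : ∀ a → eval [ a ] n ≡ a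
  eval-constant a = trans (cong (a +_) (*-zeroʳ n)) (+-identityʳ a)

  eval-⊕ : ∀ p q → eval (p ⊕ q) n ≡ eval p n + eval q n
  eval-⊕ []      q       = refl
  eval-⊕ (a ∷ p) []      = sym (+-identityʳ _)
  eval-⊕ (a ∷ p) (b ∷ q) = begin
    a + b + n * eval (p ⊕ q) n           ≡⟨ cong (λ e → a + b + n * e) (eval-⊕ p q) ⟩
    a + b + n * (eval p n + eval q n)
      ≡⟨ solve 5 (λ a b n x y → a :+ b :+ n :* (x :+ y) := a :+ n :* x :+ (b :+ n :* y)) refl a b n (eval p n) (eval q n) ⟩
    a + n * eval p n + (b + n * eval q n) ∎

  eval-· : ∀ k p → eval (k · p) n ≡ k * eval p n
  eval-· k []      = sym (*-zeroʳ k)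
  eval-· k (a ∷ p) = begin
    k * a + n * eval (k · p) n   ≡⟨ cong (λ e → k * a + n * e) (eval-· k p) ⟩
    k * a + n * (k * eval p n)
      ≡⟨ solve 4 (λ k a n x → k :* a :+ n :* (k :* x) := k :* (a :+ n :* x)) refl k a n (eval p n) ⟩
    k * (a + n * eval p n)       ∎

  eval-⊗ : ∀ p q → eval (p ⊗ q) n ≡ eval p n * eval q n
  eval-⊗ []      q = refl
  eval-⊗ (a ∷ p) q = begin
    eval (a · q ⊕ (0 ∷ p ⊗ q)) n             ≡⟨ eval-⊕ (a · q) (0 ∷ p ⊗ q) ⟩
    eval (a · q) n + n * eval (p ⊗ q) n      ≡⟨ cong₂ (λ x y → x + n * y) (eval-· a q) (eval-⊗ p q) ⟩
    a * eval q n + n * (eval p n * eval q n)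
      ≡⟨ solve 4 (λ a n x y → a :* y :+ n :* (x :* y) := (a :+ n :* x) :* y) refl a n (eval p n) (eval q n) ⟩
    (a + n * eval p n) * eval q n            ∎

  eval-⊙ : ∀ p q → eval (p ⊙ q) n ≡ eval p (eval q n)
  eval-⊙ []      q = refl
  eval-⊙ (a ∷ p) q = begin
    eval ([ a ] ⊕ q ⊗ (p ⊙ q)) n          ≡⟨ eval-⊕ [ a ] (q ⊗ (p ⊙ q)) ⟩
    eval [ a ] n + eval (q ⊗ (p ⊙ q)) n   ≡⟨ cong₂ _+_ (eval-constant a) (eval-⊗ q (p ⊙ q)) ⟩
    a + eval q n * eval (p ⊙ q) n         ≡⟨ cong (λ e → a + eval q n * e) (eval-⊙ p q) ⟩
    a + eval q n * eval p (eval q n)      ∎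

eval-mono : ∀ p {m n} → m ≤ n → eval p m ≤ eval p n
eval-mono []      m≤n = z≤n
eval-mono (a ∷ p) m≤n = +-monoʳ-≤ a (*-mono-≤ m≤n (eval-mono p m≤n))

-- The final bounds must hold at every size, not only eventually. The finitely many values below the
-- threshold are absorbed by adding their sum to the constant term.
PolyBounded⇒everywhere : ∀ {f} → PolyBounded f → ∃[ q ] ∀ n → f n ≤ eval q n
PolyBounded⇒everywhere {f} (p , k , n₀ , f≤) = [ initial ] ⊕ k · p , bounded
  where
  open ≤-Reasoning
  initial : ℕ
  initial = sum (map f (upTo n₀))

  bounded : ∀ n → f n ≤ eval ([ initial ] ⊕ k · p) n
  bounded n = begin
    f n                               ≤⟨ either (n₀ ≤? n) ⟩
    initial + k * eval p n            ≡⟨ cong₂ _+_ (eval-constant n initial) (eval-· n k p) ⟨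
    eval [ initial ] n + eval (k · p) n ≡⟨ eval-⊕ n [ initial ] (k · p) ⟨
    eval ([ initial ] ⊕ k · p) n      ∎
    where
    either : Dec (n₀ ≤ n) → f n ≤ initial + k * eval p n
    either (yes n₀≤n) = m≤n⇒m≤o+n initial (f≤ n n₀≤n)
    either (no  n₀≰n) = ≤-trans (∈⇒≤sum f (∈-upTo⁺ (≰⇒> n₀≰n))) (m≤m+n initial _)

-- Growth rates and quasipolynomials

=O-weaken : ∀ {f g g′} → (∀ n → g n ≤ g′ n) → f =O g → f =O g′
=O-weaken g≤g′ (k , n₀ , f≤) = k , n₀ , λ n n₀≤n → ≤-trans (f≤ n n₀≤n) (*-monoʳ-≤ k (g≤g′ n))

n<2^[1+⌊log₂n⌋] : ∀ n → n < 2 ^ suc ⌊log₂ n ⌋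
n<2^[1+⌊log₂n⌋] n with 2 ^ suc ⌊log₂ n ⌋ ≤? n
... | no  ≰n = ≰⇒> ≰n
... | yes ≤n = ⊥-elim (<-irrefl refl
  (subst (_≤ ⌊log₂ n ⌋) (⌊log₂[2^n]⌋≡n (suc ⌊log₂ n ⌋)) (⌊log₂⌋-mono-≤ ≤n)))

⌊log₂n⌋≤n : ∀ n → ⌊log₂ n ⌋ ≤ n
⌊log₂n⌋≤n n = subst (⌊log₂ n ⌋ ≤_) (⌊log₂[2^n]⌋≡n n) (⌊log₂⌋-mono-≤ (m≤2^m n))

-- The base `suc n` is at least 1, so its top power dominates every term, even at 0.
eval≤power : ∀ p n → eval p n ≤ sum p * suc n ^ length p
eval≤power []      n = z≤n
eval≤power (a ∷ p) n = begin
  a + n * eval p n                 ≤⟨ +-mono-≤ a≤ (*-mono-≤ (n≤1+n n) (eval≤power p n)) ⟩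
  a * u + suc n * (sum p * suc n ^ length p)
    ≡⟨ solve 4 (λ a s e n → a :* (n :* e) :+ n :* (s :* e) := (a :+ s) :* (n :* e)) refl a (sum p) (suc n ^ length p) (suc n) ⟩
  (a + sum p) * u                  ∎
  where
  open ≤-Reasoning
  open +-*-Solver
  u : ℕ
  u = suc n ^ suc (length p)
  a≤ : a ≤ a * u
  a≤ = ≤-trans (≤-reflexive (sym (*-identityʳ a))) (*-monoʳ-≤ a (m^n>0 (suc n) (suc (length p))))

quasiPolynomial : ∀ p → QuasiPolynomial (eval p)
quasiPolynomial p = 1 , s≤s z≤n , e , (length p * 2 , 2 , e≤) , (sum p , 0 , λ n _ → eval≤ n)
  where
  open ≤-Reasoning
  e : ℕ → ℕ
  e n = suc ⌊log₂ n ⌋ * length p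

  e≤ : ∀ n → 2 ≤ n → e n ≤ length p * 2 * ⌊log₂ n ⌋ ^ 1
  e≤ n 2≤n = begin
    suc ⌊log₂ n ⌋ * length p           ≤⟨ *-monoˡ-≤ (length p) (+-monoˡ-≤ ⌊log₂ n ⌋ (⌊log₂⌋-mono-≤ 2≤n)) ⟩
    (⌊log₂ n ⌋ + ⌊log₂ n ⌋) * length p ≡⟨ solve 2 (λ x y → (x :+ x) :* y := y :* con 2 :* (x :* con 1)) refl ⌊log₂ n ⌋ (length p) ⟩
    length p * 2 * ⌊log₂ n ⌋ ^ 1       ∎
    where open +-*-Solver

  eval≤ : ∀ n → eval p n ≤ sum p * 2 ^ e n
  eval≤ n = begin
    eval p n                                ≤⟨ eval≤power p n ⟩
    sum p * suc n ^ length p                ≤⟨ *-monoʳ-≤ (sum p) (^-monoˡ-≤ (length p) (n<2^[1+⌊log₂n⌋] n)) ⟩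
    sum p * (2 ^ suc ⌊log₂ n ⌋) ^ length p  ≡⟨ cong (sum p *_) (^-*-assoc 2 (suc ⌊log₂ n ⌋) (length p)) ⟩
    sum p * 2 ^ e n                         ∎

-- Kernel size

module _ {σ : ℕ} where

  tapeSize : ∀ {work} → Tape σ work → ℕ
  tapeSize (tape l _ r) = length l + suc (length r)

  move-size : ∀ {work} d s (t : Tape σ work) → tapeSize (move d (write s t)) ≤ suc (tapeSize t)
  move-size left  s (tape [] _ r)      = ≤-refl
  move-size left  s (tape (a ∷ l) _ r) = ≤-trans (≤-reflexive (+-suc (length l) _)) (n≤1+n _)
  move-size stay  s (tape l _ r)       = n≤1+n _
  move-size right s (tape l _ [])      = ≤-refl
  move-size right s (tape l _ (b ∷ r)) = ≤-trans (≤-reflexive (sym (+-suc (length l) _))) (n≤1+n _)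

  halts-size : ∀ (M : Machine σ) {q t n u} → HaltsFrom M q t n u → tapeSize u ≤ n + tapeSize t
  halts-size M (halt _) = ≤-refl
  halts-size M {t = t} {suc n} {u} (step {s = s} {d} _ run) = begin
    tapeSize u                            ≤⟨ halts-size M run ⟩
    n + tapeSize (move d (write s t))     ≤⟨ +-monoʳ-≤ n (move-size d s t) ⟩
    n + suc (tapeSize t)                  ≡⟨ +-suc n _ ⟩
    suc n + tapeSize t                    ∎
    where open ≤-Reasoning

  input-size : ∀ {work} (w : Word σ) → tapeSize {work} (input w) ≤ suc (length w)
  input-size []      = ≤-refl
  input-size (a ∷ w) = s≤s (≤-trans (≤-reflexive (length-map io w)) (n≤1+n _))

  output-size : ∀ {work} (t : Tape σ work) {w} → Outputs t w → length w ≤ tapeSize t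
  output-size (tape l s r) {w} (m , out) = begin
    length w                                             ≡⟨ length-map io w ⟨
    length (map io w)                                    ≤⟨ m≤m+n _ _ ⟩
    length (map io w) + length (replicate m blank)       ≡⟨ length-++ (map io w) ⟨
    length (map io w ++ replicate m blank)               ≡⟨ cong length out ⟨
    suc (length r)                                       ≤⟨ m≤n+m _ (length l) ⟩
    length l + suc (length r)                            ∎
    where open ≤-Reasoning

  computes-size : ∀ (M : Machine σ) {w n w′} → Computes M w n w′ → length w′ ≤ n + suc (length w)
  computes-size M {w} {n} (u , run , out) =
    ≤-trans (output-size u out) (≤-trans (halts-size M run) (+-monoʳ-≤ n (input-size w)))

  codeCNF-size : ∀ Φ → ∣ Φ ∣ ≤ length (codeCNF {σ} Φ)
  codeCNF-size []      = z≤n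
  codeCNF-size (C ∷ Φ) = begin
    suc (length C) + ∣ Φ ∣
      ≤⟨ +-mono-≤ (clause-size C) (codeCNF-size Φ) ⟩
    length (concatMap (codeLiteral {σ}) C ++ [ semicolon ]) + length (codeCNF {σ} Φ)
      ≡⟨ length-++ (concatMap (codeLiteral {σ}) C ++ [ semicolon ]) ⟨
    length (codeCNF {σ} (C ∷ Φ)) ∎
    where
    open ≤-Reasoning
    literal-size : ∀ l → 1 ≤ length (codeLiteral {σ} l)
    literal-size (pos x) = s≤s z≤n
    literal-size (neg x) = s≤s z≤n

    literals-size : ∀ C → length C ≤ length (concatMap (codeLiteral {σ}) C)
    literals-size []      = z≤n
    literals-size (l ∷ C) = ≤-trans (+-mono-≤ (literal-size l) (literals-size C))
                                    (≤-reflexive (sym (length-++ (codeLiteral l))))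

    clause-size : ∀ C → suc (length C) ≤ length (concatMap (codeLiteral {σ}) C ++ [ semicolon ])
    clause-size C = begin
      1 + length C                                        ≡⟨ +-comm 1 _ ⟩
      length C + 1                                        ≤⟨ +-monoˡ-≤ 1 (literals-size C) ⟩
      length (concatMap (codeLiteral {σ}) C) + 1          ≡⟨ length-++ (concatMap codeLiteral C) ⟨
      length (concatMap (codeLiteral {σ}) C ++ [ semicolon ]) ∎

  codeInstance-size : ∀ (i : Instance σ) → length (codeInstance i) ≡ length (proj₁ i) + suc (proj₂ i)
  codeInstance-size (x , k) =
    trans (length-++ (map letter x)) (cong₂ (λ a b → a + suc b) (length-map letter x) (length-replicate k))

  -- A machine step touches at most one new cell, so an output is no longer than the running time
  -- plus the input; and every clause and literal takes at least one letter of the code. Polynomial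
  -- time therefore bounds the formula size.
  translation-size : ∀ {L : ParamProblem σ} (T : Translation L) →
                     Σ Poly λ P → ∀ {b i} → SizeAtMost L b i → ∣ Translation.Φ T i ∣ ≤ eval P b
  translation-size {L} T with M , p , run ← Translation.polyTime T = P , bounded
    where
    open ≤-Reasoning
    double P : Poly
    -- The running time is measured in the sum of two quantities that are each at most `b`, hence
    -- `2 * b`; the summand `2 + 2 * b` is for the input, its separator and the scanned cell.
    double = 0 ∷ 2 ∷ []
    P = p ⊙ double ⊕ (2 ∷ 2 ∷ [])

    bounded : ∀ {b i} → SizeAtMost L b i → ∣ Translation.Φ T i ∣ ≤ eval P b
    bounded {b} {x , k} (x≤b , k≤b) with t , t≤ , comp ← run (x , k) = begin
      ∣ Translation.Φ T (x , k) ∣                    ≤⟨ codeCNF-size (Translation.Φ T (x , k)) ⟩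
      length (codeCNF {σ} (Translation.Φ T (x , k))) ≤⟨ computes-size M comp ⟩
      t + suc (length (codeInstance (x , k)))        ≡⟨ cong (λ l → t + suc l) (codeInstance-size (x , k)) ⟩
      t + suc (length x + suc k)                     ≤⟨ +-mono-≤ t≤ (s≤s (+-mono-≤ x≤b (s≤s k≤b))) ⟩
      eval p (length x + k) + suc (b + suc b)
        ≤⟨ +-monoˡ-≤ _ (eval-mono p (≤-trans (+-mono-≤ x≤b k≤b) (≤-reflexive double-b))) ⟩
      eval p (eval double b) + suc (b + suc b)       ≡⟨ cong₂ _+_ (sym (eval-⊙ b p double)) linear ⟩
      eval (p ⊙ double) b + eval (2 ∷ 2 ∷ []) b      ≡⟨ eval-⊕ b (p ⊙ double) (2 ∷ 2 ∷ []) ⟨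
      eval P b                                       ∎
      where
      open +-*-Solver
      double-b : b + b ≡ eval double b
      double-b = solve 1 (λ b → b :+ b := b :* (con 2 :+ b :* con 0)) refl b
      linear : suc (b + suc b) ≡ eval (2 ∷ 2 ∷ []) b
      linear = solve 1 (λ b → con 1 :+ (b :+ (con 1 :+ b)) := con 2 :+ b :* (con 2 :+ b :* con 0)) refl b

-- Reduction chains

geometric : ℕ → ℕ → ℕ
geometric R m = sum (map (R ^_) (upTo (suc m)))

geometric-suc : ∀ R m → geometric R (suc m) ≡ 1 + R * geometric R m
geometric-suc R m = begin
  geometric R (suc m)                                ≡⟨ cong sum (map-upTo (R ^_) (suc (suc m))) ⟩
  1 + sum (applyUpTo (λ j → R * R ^ j) (suc m))      ≡⟨ cong (1 +_) (factor (R ^_) (suc m)) ⟩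
  1 + R * sum (applyUpTo (R ^_) (suc m))             ≡⟨ cong (λ js → 1 + R * sum js) (map-upTo (R ^_) (suc m)) ⟨
  1 + R * geometric R m                              ∎
  where
  open ≡-Reasoning
  factor : ∀ f n → sum (applyUpTo (λ j → R * f j) n) ≡ R * sum (applyUpTo f n)
  factor f zero    = sym (*-zeroʳ R)
  factor f (suc n) = trans (cong (R * f 0 +_) (factor (f ∘ suc) n)) (sym (*-distribˡ-+ R (f 0) _))

geometric-one : ∀ m → geometric 1 m ≡ suc m
geometric-one zero    = refl
geometric-one (suc m) = trans (geometric-suc 1 m) (cong suc (trans (+-identityʳ _) (geometric-one m)))

module _ (F : FregeSystem) where

  open Constant F

  stepCost : (s R n : ℕ) → ℕ
  stepCost s R n = s * perLine + R * (c + n)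

  chainCost : (s R m n : ℕ) → ℕ
  chainCost s R zero    n = n
  chainCost s R (suc m) n = stepCost s R (chainCost s R m n)

  -- The extra `c` on the left strengthens the induction: it is the `c` that `stepCost` pays in
  -- every case, and at the top it pays for discharging the trivial assumption. The `1` in
  -- `geometric-suc` absorbs the cost of the step itself.
  chainCost-bound : ∀ s R m e → c + chainCost s R m (c * 2 ^ e) ≤ perLine * (geometric R m * (s + 2 ^ e))
  chainCost-bound s R zero e = begin
    c + c * 2 ^ e                    ≤⟨ +-mono-≤ (≤-trans (≤-reflexive (sym (*-identityʳ c))) (*-monoʳ-≤ c (m^n>0 2 e))) (m≤m+n (c * 2 ^ e) (3 * (c * 2 ^ e))) ⟩
    c * 2 ^ e + 4 * (c * 2 ^ e)      ≡⟨ solve 2 (λ c x → c :* x :+ con 4 :* (c :* x) := (con 2 :* c :+ con 3 :* c) :* (con 1 :* x)) refl c (2 ^ e) ⟩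
    perLine * (1 * 2 ^ e)            ≤⟨ *-monoʳ-≤ perLine (*-monoʳ-≤ 1 (m≤n+m (2 ^ e) s)) ⟩
    perLine * (1 * (s + 2 ^ e))      ∎
    where
    open ≤-Reasoning
    open +-*-Solver
  chainCost-bound s R (suc m) e = begin
    c + (s * perLine + R * (c + chainCost s R m (c * 2 ^ e)))
      ≤⟨ +-mono-≤ c≤perLine (+-monoʳ-≤ (s * perLine) (*-monoʳ-≤ R (chainCost-bound s R m e))) ⟩
    perLine * 2 ^ e + (s * perLine + R * (perLine * (G * B)))
      ≡⟨ solve 5 (λ l x s r g → l :* x :+ (s :* l :+ r :* (l :* (g :* (s :+ x)))) := l :* ((con 1 :+ r :* g) :* (s :+ x)))
           refl perLine (2 ^ e) s R G ⟩
    perLine * ((1 + R * G) * B)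
      ≡⟨ cong (λ g → perLine * (g * B)) (geometric-suc R m) ⟨
    perLine * (geometric R (suc m) * B) ∎
    where
    open ≤-Reasoning
    open +-*-Solver
    G B : ℕ
    G = geometric R m
    B = s + 2 ^ e
    c≤perLine : c ≤ perLine * 2 ^ e
    c≤perLine = begin
      c                ≡⟨ *-identityʳ c ⟨
      c * 1            ≤⟨ *-mono-≤ (≤-trans (m≤m+n c _) (m≤m+n (2 * c) (3 * c))) (m^n>0 2 e) ⟩
      perLine * 2 ^ e  ∎

  module _ (κ : Kind) (Φ : CNF) where

    open Derivability F κ (clauses Φ) [ ⊥ᶠ ]

    refutation : ∀ {n} → Refutes Φ n → Refutable F κ Φ (c + n)
    refutation {n} refutes =
      let extension P _ r size≤ = _⊢[_]_.extend derived done λ ()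
      in record { lines = _ ; proof = P ; concludes = r } , ≤-trans size≤ (≤-reflexive (+-identityʳ (c + n)))
      where
      derived : [] ⊢[ c + n ] [ ⊥ᶠ ]
      -- At the start no case has been assumed, so `D` is the provable `¬ᶠ ⊥ᶠ`, which is detached at
      -- the end.
      derived = relax bounded (detach (schemeInstance verum {⊥ᶠ} {⊥ᶠ} {⊥ᶠ}) (refutes (¬ᶠ ⊥ᶠ) var λ {A} A∈ →
        relax (≤-trans (≤-reflexive (cong suc (+-comm _ 1))) (schemeSize≤c constant))
          (≡-⊢ (cong (¬ᶠ ⊥ᶠ ⇒ᶠ_) (sym (⟨var⟩ A)))
            (detach (hypothesis A∈) (schemeInstance constant {b = ⊥ᶠ})))))
        where
        open ≤-Reasoning
        bounded : suc n + schemeSize verum ≤ c + n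
        bounded = begin
          suc n + schemeSize verum   ≡⟨ +-comm (suc n) _ ⟩
          schemeSize verum + suc n   ≡⟨ +-suc _ n ⟩
          suc (schemeSize verum) + n ≤⟨ +-monoˡ-≤ n (≤-trans (n≤1+n _) (schemeSize≤c verum)) ⟩
          c + n                      ∎

  -- The common interface of `refuteStep` and `refuteSafe`. The kind of the refutation is
  -- independent of the kind of the witnesses.
  PropagatesRefutations : (R s : ℕ) (Φ Φ′ : CNF) → Set
  PropagatesRefutations R s Φ Φ′ = ∀ κ Γ Δ {n} →
    let open Derivability F κ Γ Δ in Refutes Φ′ n → Refutes Φ (stepCost s R n)

  module _ {σ : ℕ} {L : ParamProblem σ} (T : Translation L) {r : ℕ} (A : Fin r → Rule L) where

    open Translation T

    end-negative : ∀ {i m} (ch : Chain A i m) → Negative L i → Negative L (end A ch)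
    end-negative (stop _)        ¬L = ¬L
    end-negative {i} (step j ch) ¬L = end-negative ch (¬L ∘ Equivalence.from (Rule.equivalent (A j) i))

    refuteChain : ∀ κ Γ Δ {R s i m n} (ch : Chain A i m) →
                  let open Derivability F κ Γ Δ in
                  (∀ {a b} → (a , b) ∈ steps A ch → PropagatesRefutations R s (Φ a) (Φ b)) →
                  Refutes (Φ (end A ch)) n → Refutes (Φ i) (chainCost s R m n)
    refuteChain κ Γ Δ (stop _)    propagates refutes = refutes
    refuteChain κ Γ Δ (step j ch) propagates refutes =
      propagates (here refl) κ Γ Δ (refuteChain κ Γ Δ ch (propagates ∘ there) refutes)

    KernelBound : Kind → (C : Instance σ → ℕ) (h g : ℕ → ℕ) (R : ℕ) → Set
    KernelBound κ C h g R = ∃[ K ] Σ Poly λ P → ∀ i → Negative L i →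
      Refutable F κ (Φ i) (K * (geometric R (C i) * (h ∣ Φ i ∣ + 2 ^ eval P (g (proj₂ i)))))

    kernelBound : ∀ {g} → KernelizableVia A g → ∀ κ {C h R} (chain : NegativeChains A C) →
                  (∀ i (n : Negative L i) {a b} → (a , b) ∈ steps A (chain i n) →
                   PropagatesRefutations R (h ∣ Φ i ∣) (Φ a) (Φ b)) →
                  KernelBound κ C h g R
    kernelBound {g} kernelizable κ {C} {h} {R} chain propagates
      with P , Φ≤P ← translation-size T = perLine , exponent , refutable
      where
      open ≤-Reasoning
      -- The truth table bound has exponent `N + 2 * (2 + N)`, which is `4 + 3 * N`.
      exponent : Poly
      exponent = [ 4 ] ⊕ 3 · P

      refutable : ∀ i → Negative L i →
                  Refutable F κ (Φ i) (perLine * (geometric R (C i) * (h ∣ Φ i ∣ + 2 ^ eval exponent (g (proj₂ i)))))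
      refutable i ¬L = proj₁ refuted , ≤-trans (proj₂ refuted) (chainCost-bound (h ∣ Φ i ∣) R (C i) (eval exponent (g (proj₂ i))))
        where
        open Derivability F κ (clauses (Φ i)) [ ⊥ᶠ ]
        e : Instance σ
        e = end A (chain i ¬L)

        N : ℕ
        N = ∣ Φ e ∣

        unsatisfiable : ¬ Satisfiable (Φ e)
        unsatisfiable = end-negative (chain i ¬L) ¬L ∘ Equivalence.to (correct e)

        G : ℕ
        G = g (proj₂ i)

        N≤ : N + 2 * (2 + N) ≤ eval exponent G
        N≤ = begin
          N + 2 * (2 + N)              ≡⟨ solve 1 (λ n → n :+ con 2 :* (con 2 :+ n) := con 4 :+ con 3 :* n) refl N ⟩
          -- The given chain may apply the rules in another order than the kernelization procedure,
          -- hence the size bound for any order.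
          4 + 3 * N                    ≤⟨ +-monoʳ-≤ 4 (*-monoʳ-≤ 3 (Φ≤P (KernelizableVia.anyOrder kernelizable (chain i ¬L)))) ⟩
          4 + 3 * eval P G ≡⟨ cong₂ _+_ (eval-constant G 4) (eval-· G 3 P) ⟨
          eval [ 4 ] G + eval (3 · P) G ≡⟨ eval-⊕ G [ 4 ] (3 · P) ⟨
          eval exponent G  ∎
          where open +-*-Solver

        refutesEnd : Refutes (Φ e) (c * 2 ^ eval exponent G)
        refutesEnd D τ given =
          relax (*-monoʳ-≤ c (^-monoʳ-≤ 2 N≤)) (refuteUnsatisfiable unsatisfiable D τ given)

        refuted : Refutable F κ (Φ i) (c + chainCost (h ∣ Φ i ∣) R (C i) (c * 2 ^ eval exponent G))
        refuted = refutation κ (Φ i)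
          (refuteChain κ (clauses (Φ i)) [ ⊥ᶠ ] (chain i ¬L) (propagates i ¬L) refutesEnd)


    polynomialBound : ∀ {g κ C h} → KernelBound κ C h g 1 → PolyBounded h →
                      (∀ k → Σ Poly λ p → LengthO T C k (eval p)) →
                      ∀ k → Σ Poly λ q → RefutableWithin T F κ k (eval q)
    polynomialBound {g} {κ} {C} {h} (K , P , refutable) h-poly C-poly k
      with p , f , f=O , C≤f ← C-poly k
      with pᶠ , f≤ ← PolyBounded⇒everywhere (p , f=O)
      with pʰ , h≤ ← PolyBounded⇒everywhere h-poly = q , within
      where
      open ≤-Reasoning
      -- For fixed `k` the whole truth table contributes a constant.
      E : ℕ
      E = 2 ^ eval P (g k)

      q : Poly
      q = K · (([ 1 ] ⊕ pᶠ) ⊗ (pʰ ⊕ [ E ]))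

      eval-q : ∀ n → eval q n ≡ K * ((1 + eval pᶠ n) * (eval pʰ n + E))
      eval-q n = begin-equality
        eval q n
          ≡⟨ eval-· n K (([ 1 ] ⊕ pᶠ) ⊗ (pʰ ⊕ [ E ])) ⟩
        K * eval (([ 1 ] ⊕ pᶠ) ⊗ (pʰ ⊕ [ E ])) n
          ≡⟨ cong (K *_) (eval-⊗ n ([ 1 ] ⊕ pᶠ) (pʰ ⊕ [ E ])) ⟩
        K * (eval ([ 1 ] ⊕ pᶠ) n * eval (pʰ ⊕ [ E ]) n)
          ≡⟨ cong (K *_) (cong₂ _*_ (trans (eval-⊕ n [ 1 ] pᶠ) (cong (_+ eval pᶠ n) (eval-constant n 1)))
                                    (trans (eval-⊕ n pʰ [ E ]) (cong (eval pʰ n +_) (eval-constant n E)))) ⟩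
        K * ((1 + eval pᶠ n) * (eval pʰ n + E)) ∎

      within : RefutableWithin T F κ k (eval q)
      within x ¬L with d , d≤ ← refutable (x , k) ¬L = d , (begin
        Derivation.size d
          ≤⟨ d≤ ⟩
        K * (geometric 1 (C (x , k)) * (h n + E))
          ≡⟨ cong (λ m → K * (m * (h n + E))) (geometric-one (C (x , k))) ⟩
        K * (suc (C (x , k)) * (h n + E))
          ≤⟨ *-monoʳ-≤ K (*-mono-≤ (s≤s (≤-trans (C≤f x ¬L) (f≤ n))) (+-monoˡ-≤ E (h≤ n))) ⟩
        K * ((1 + eval pᶠ n) * (eval pʰ n + E))
          ≡⟨ eval-q n ⟨
        eval q n ∎)
        where
        n : ℕ
        n = ∣ Φ (x , k) ∣

theorem1 : (F : FregeSystem) {σ : ℕ} (L : ParamProblem σ) (T : Translation L)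
    {r : ℕ} (A : Fin r → Rule L) (g : ℕ → ℕ) → KernelizableVia A g →
    let open Translation T in
    ( (C : Instance σ → ℕ) (h : ℕ → ℕ) (R : ℕ) → 1 ≤ R →
    (chain : NegativeChains A C) →
    SoundnessWitnessed A F T extended chain R h →
    ( ∃[ K ] Σ Poly λ P → ∀ i → Negative L i →
    Refutable F extended (Φ i)
    (K * (sum (map (R ^_) (upTo (suc (C i))))
    * (h ∣ Φ i ∣ + 2 ^ eval P (g (proj₂ i))))) )
    × ( R ≡ 1 → PolyBounded h →
    (∀ k → Σ Poly λ p → LengthO T C k (eval p)) →
    ∀ k → Σ Poly λ q → RefutableWithin T F extended k (eval q) ) )
    ×
    ( (C : Instance σ → ℕ) (p : Poly) (chain : NegativeChains A C) →
    SafetyWitnessed A F T frege chain (eval p) →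
    ( (∀ k → LengthO T C k (λ _ → 1)) →
    ∀ k → Σ Poly λ q → RefutableWithin T F frege k (eval q) )
    × ( (∀ k → LengthO T C k (λ n → ⌊log₂ n ⌋)) →
    ∀ k → Σ (ℕ → ℕ) λ f → QuasiPolynomial f × RefutableWithin T F frege k f ) )
theorem1 F {σ} L T A g kernelizable = part₁ , part₂
  where
  part₁ : ∀ (C : Instance σ → ℕ) (h : ℕ → ℕ) (R : ℕ) → 1 ≤ R → (chain : NegativeChains A C) →
          SoundnessWitnessed A F T extended chain R h →
          KernelBound F T A extended C h g R ×
          (R ≡ 1 → PolyBounded h → (∀ k → Σ Poly λ p → LengthO T C k (eval p)) →
           ∀ k → Σ Poly λ q → RefutableWithin T F extended k (eval q))
  part₁ C h R _ chain sound = bound , λ { refl → polynomialBound F T A {g = g} bound }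
    where
    bound : KernelBound F T A extended C h g R
    bound = kernelBound F T A kernelizable extended {h = h} chain
      λ i ¬L step∈ κ Γ Δ → Derivability.refuteStep F κ Γ Δ (sound i ¬L step∈)

  part₂ : ∀ (C : Instance σ → ℕ) (p : Poly) (chain : NegativeChains A C) →
          SafetyWitnessed A F T frege chain (eval p) →
          ((∀ k → LengthO T C k (λ _ → 1)) →
           ∀ k → Σ Poly λ q → RefutableWithin T F frege k (eval q)) ×
          ((∀ k → LengthO T C k (λ n → ⌊log₂ n ⌋)) →
           ∀ k → Σ (ℕ → ℕ) λ f → QuasiPolynomial f × RefutableWithin T F frege k f)
  part₂ C p chain safe = constantLength , logarithmicLength
    where
    polynomial : (∀ k → Σ Poly λ q → LengthO T C k (eval q)) →
                 ∀ k → Σ Poly λ q → RefutableWithin T F frege k (eval q)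
    polynomial = polynomialBound F T A {g = g} {h = eval p}
      (kernelBound F T A kernelizable frege {h = eval p} chain
        λ i ¬L step∈ κ Γ Δ → Derivability.refuteSafe F κ Γ Δ (safe i ¬L step∈))
      (p , 1 , 0 , λ n _ → ≤-reflexive (sym (+-identityʳ _)))

    constantLength : (∀ k → LengthO T C k (λ _ → 1)) →
                     ∀ k → Σ Poly λ q → RefutableWithin T F frege k (eval q)
    constantLength C=O = polynomial λ k → let f , f=O , C≤f = C=O k in
      [ 1 ] , f , =O-weaken (λ n → ≤-reflexive (sym (eval-constant n 1))) f=O , C≤f

    -- Counting lines, even a logarithmic chain costs only a polynomial.
    logarithmicLength : (∀ k → LengthO T C k (λ n → ⌊log₂ n ⌋)) →
                        ∀ k → Σ (ℕ → ℕ) λ f → QuasiPolynomial f × RefutableWithin T F frege k f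
    logarithmicLength C=O k =
      let q , within = polynomial (λ k → let f , f=O , C≤f = C=O k in
                         -- The identity polynomial dominates the logarithm.
                         0 ∷ [ 1 ] , f , =O-weaken identity f=O , C≤f) k
      in eval q , quasiPolynomial q , within
      where
      identity : ∀ n → ⌊log₂ n ⌋ ≤ eval (0 ∷ [ 1 ]) n
      identity n = ≤-trans (⌊log₂n⌋≤n n)
        (≤-reflexive (sym (trans (cong (n *_) (eval-constant n 1)) (*-identityʳ n))))
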